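{- For every real number $\alpha \in [0,1]$ there exists a sequence $S \in \mathbf{C}$ such that $\dim(S) = \alpha$.
   Context: Strings are elements of $\{0,1\}^*$; $\mathbf{C}$ (Cantor space) is the set of all infinite binary sequences $S = S[0]S[1]S[2]\ldots$; $S[0..n-1]$ is the string of the first $n$ bits of $S$. A function $f : D \to \mathbb{R}$ on a discrete domain $D$ (such as $\mathbb{N}$ or $\{0,1\}^*$) is lower semicomputable if there is a computable $\hat f : D \times \mathbb{N} \to \mathbb{Q}$ with $\hat f(x,t) \le \hat f(x,t+1) < f(x)$ for all $x,t$ and $\lim_{t\to\infty} \hat f(x,t) = f(x)$ for all $x$. For $s \in [0,\infty)$, an $s$-supergale is a function $d : \{0,1\}^* \to [0,\infty)$ such that $d(w) \ge 2^{ -s}[d(w0)+d(w1)]$ for all $w \in \{0,1\}^*$. It is constructive if it is lower semicomputable. It succeeds on $S \in \mathbf{C}$ if $\limsup_{n\to\infty} d(S[0..n-1]) = \infty$; $S^\infty[d]$ is the set of all $S \in \mathbf{C}$ on which $d$ succeeds. For $X \subseteq \mathbf{C}$, the constructive dimension $\mathrm{cdim}(X)$ is the infimum of all $s \in [0,\infty)$ for which there is a constructive $s$-supergale $d$ with $X \subseteq S^\infty[d]$. The dimension of $S \in \mathbf{C}$ is $\dim(S) = \mathrm{cdim}(\{S\})$. -}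

module Defs where

open import Algebra.Bundles using (CommutativeRing)
open import Algebra.Definitions.RawSemiring using (_^_)
import Algebra.Properties.Group as GroupProperties
import Algebra.Properties.Semiring.Exp as Exp
open import Data.Bool.Base using (Bool; true; false)
open import Data.Fin.Base using (Fin)
open import Data.Integer.Base as ℤ using (ℤ; +_; -[1+_])
import Data.Integer.Properties as ℤ
open import Data.List.Base using (List; []; _∷_; _∷ʳ_; applyUpTo)
open import Data.Nat.Base as ℕ using (ℕ; zero; suc)
import Data.Nat.Properties as ℕ
open import Data.Product.Base using (Σ-syntax; ∃-syntax; _×_; _,_)
open import Data.Rational.Base as ℚ using (ℚ; 0ℚ; 1ℚ; ½; ↥_; ↧ₙ_)
import Data.Rational.Properties as ℚ
open import Data.Sum.Base using (_⊎_; inj₁; inj₂)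
open import Data.Vec.Base using (Vec; []; _∷_; lookup)
open import Data.Vec.Relation.Binary.Pointwise.Inductive using (Pointwise)
open import Relation.Binary.Definitions using (tri<; tri≈; tri>)
open import Relation.Binary.PropositionalEquality
  using (_≡_; _≗_; refl; sym; trans; cong; subst; subst₂)
open import Relation.Nullary using (¬_; contradiction)

------------------------------------------------------------------------
-- Rational arithmetic

infixr 8 _^ℚ_
_^ℚ_ : ℚ → ℕ → ℚ
_^ℚ_ = _^_ ℚ.+-*-rawSemiring

2ℚ : ℚ
2ℚ = + 2 ℚ./ 1

2^ℤ_ : ℤ → ℚ
2^ℤ (+ n)    = 2ℚ ^ℚ n
2^ℤ -[1+ n ] = ½ ^ℚ suc n

module ℚ-Lemmas where
  p-1<p : ∀ p → p ℚ.- 1ℚ ℚ.< p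
  p-1<p p = subst (p ℚ.- 1ℚ ℚ.<_) (ℚ.+-identityʳ p)
              (ℚ.+-monoʳ-< p (ℚ.negative⁻¹ (ℚ.- 1ℚ)))

  *-mono-≤-nn : ∀ {p q r s} → 0ℚ ℚ.≤ p → 0ℚ ℚ.≤ s → p ℚ.≤ q → r ℚ.≤ s →
                p ℚ.* r ℚ.≤ q ℚ.* s
  *-mono-≤-nn {p} {q} {r} {s} 0≤p 0≤s p≤q r≤s = ℚ.≤-trans
    (ℚ.*-monoˡ-≤-nonNeg p {{ℚ.nonNegative 0≤p}} r≤s)
    (ℚ.*-monoʳ-≤-nonNeg s {{ℚ.nonNegative 0≤s}} p≤q)

  *-mono-<-nn : ∀ {p q r s} → 0ℚ ℚ.≤ p → 0ℚ ℚ.≤ r → p ℚ.< q → r ℚ.< s →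
                p ℚ.* r ℚ.< q ℚ.* s
  *-mono-<-nn {p} {q} {r} {s} 0≤p 0≤r p<q r<s = ℚ.≤-<-trans
    (ℚ.*-monoˡ-≤-nonNeg p {{ℚ.nonNegative 0≤p}} (ℚ.<⇒≤ r<s))
    (ℚ.*-monoˡ-<-pos s {{ℚ.positive (ℚ.≤-<-trans 0≤r r<s)}} p<q)

  0≤p*q : ∀ {p q} → 0ℚ ℚ.≤ p → 0ℚ ℚ.≤ q → 0ℚ ℚ.≤ p ℚ.* q
  0≤p*q {p} {q} 0≤p 0≤q = ℚ.nonNegative⁻¹ (p ℚ.* q)
    {{ℚ.nonNeg*nonNeg⇒nonNeg p {{ℚ.nonNegative 0≤p}} q {{ℚ.nonNegative 0≤q}}}}

  0≤p^n : ∀ {p} → 0ℚ ℚ.≤ p → ∀ n → 0ℚ ℚ.≤ p ^ℚ n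
  0≤p^n 0≤p zero    = ℚ.nonNegative⁻¹ 1ℚ
  0≤p^n 0≤p (suc n) = 0≤p*q 0≤p (0≤p^n 0≤p n)

  ^-mono-< : ∀ {p q} → 0ℚ ℚ.≤ p → p ℚ.< q → ∀ n → p ^ℚ suc n ℚ.< q ^ℚ suc n
  ^-mono-< {p} {q} 0≤p p<q zero =
    subst₂ ℚ._<_ (sym (ℚ.*-identityʳ p)) (sym (ℚ.*-identityʳ q)) p<q
  ^-mono-< 0≤p p<q (suc n) =
    *-mono-<-nn 0≤p (0≤p^n 0≤p (suc n)) p<q (^-mono-< 0≤p p<q n)

  0^≤0 : ∀ n → 0ℚ ^ℚ suc n ℚ.≤ 0ℚ
  0^≤0 n = ℚ.≤-reflexive (ℚ.*-zeroˡ (0ℚ ^ℚ n))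

  halves : ∀ p → p ≡ p ℚ.* ½ ℚ.+ p ℚ.* ½
  halves p = trans (sym (ℚ.*-identityʳ p)) (ℚ.*-distribˡ-+ p ½ ½)

  neg-involutive : ∀ p → ℚ.- (ℚ.- p) ≡ p
  neg-involutive p = GroupProperties.⁻¹-involutive ℚ.+-0-group p

  ℚ-semiring = CommutativeRing.semiring ℚ.+-*-commutativeRing

  0≤2 : 0ℚ ℚ.≤ 2ℚ
  0≤2 = ℚ.nonNegative⁻¹ 2ℚ

  1≤2^ : ∀ n → 1ℚ ℚ.≤ 2ℚ ^ℚ n
  1≤2^ zero    = ℚ.≤-refl
  1≤2^ (suc n) = *-mono-≤-nn (ℚ.nonNegative⁻¹ 1ℚ) (0≤p^n 0≤2 n)
    (ℚ.≤ᵇ⇒≤ {1ℚ} {2ℚ} _) (1≤2^ n)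

  2^-mono : ∀ {m n} → m ℕ.≤ n → 2ℚ ^ℚ m ℚ.≤ 2ℚ ^ℚ n
  2^-mono {n = n} ℕ.z≤n = 1≤2^ n
  2^-mono (ℕ.s≤s m≤n)   = ℚ.*-monoˡ-≤-nonNeg 2ℚ (2^-mono m≤n)

  ½^≤1 : ∀ n → ½ ^ℚ n ℚ.≤ 1ℚ
  ½^≤1 zero    = ℚ.≤-refl
  ½^≤1 (suc n) = *-mono-≤-nn (ℚ.nonNegative⁻¹ ½) (ℚ.nonNegative⁻¹ 1ℚ)
    (ℚ.≤ᵇ⇒≤ {½} {1ℚ} _) (½^≤1 n)

  2^ℤ≤2^ : ∀ i {n} → i ℤ.≤ + n → 2^ℤ i ℚ.≤ 2ℚ ^ℚ n
  2^ℤ≤2^ (+ m)    (ℤ.+≤+ m≤n) = 2^-mono m≤n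
  2^ℤ≤2^ -[1+ m ] {n} _       = ℚ.≤-trans (½^≤1 (suc m)) (1≤2^ n)

  0≤2^ℤ : ∀ i → 0ℚ ℚ.≤ 2^ℤ i
  0≤2^ℤ (+ n)    = 0≤p^n 0≤2 n
  0≤2^ℤ -[1+ n ] = 0≤p^n (ℚ.nonNegative⁻¹ ½) (suc n)

  i≤∣i∣ : ∀ i → i ℤ.≤ + ℤ.∣ i ∣
  i≤∣i∣ (+ n)    = ℤ.≤-refl
  i≤∣i∣ -[1+ n ] = ℤ.-≤+

  ↥r≤∣↥b∣*↧r : ∀ {r b} → r ℚ.< b → ↥ r ℤ.≤ + (ℤ.∣ ↥ b ∣ ℕ.* ↧ₙ r)
  ↥r≤∣↥b∣*↧r {r} {b} r<b = go (↥ r) (ℤ.<⇒≤ (ℚ.drop-*<* r<b))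
    where
    go : ∀ i → i ℤ.* + ↧ₙ b ℤ.≤ ↥ b ℤ.* + ↧ₙ r → i ℤ.≤ + (ℤ.∣ ↥ b ∣ ℕ.* ↧ₙ r)
    go -[1+ _ ] _  = ℤ.-≤+
    go (+ m)    le = ℤ.≤-trans
      (subst (+ m ℤ.≤_) (ℤ.pos-* m (↧ₙ b)) (ℤ.+≤+ (ℕ.m≤m*n m (↧ₙ b))))
      (ℤ.≤-trans le
        (subst (↥ b ℤ.* + ↧ₙ r ℤ.≤_) (sym (ℤ.pos-* ℤ.∣ ↥ b ∣ (↧ₙ r)))
          (ℤ.*-monoʳ-≤-nonNeg (+ ↧ₙ r) (i≤∣i∣ (↥ b)))))

open ℚ-Lemmas

------------------------------------------------------------------------
-- Real numbers

-- A real is a Dedekind cut, given by its set of rationals strictly below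
-- it: nonempty, bounded above, downward closed and without a greatest
-- element.  One-sided cuts are the reals of classical mathematics; they
-- are to be read in the presence of excluded middle.
record ℝ : Set₁ where
  field
    _∋_       : ℚ → Set
    inhabited : ∃[ q ] _∋_ q
    bounded   : ∃[ q ] ¬ _∋_ q
    closed    : ∀ {p q} → p ℚ.< q → _∋_ q → _∋_ p
    rounded   : ∀ {p} → _∋_ p → ∃[ q ] (p ℚ.< q × _∋_ q)

open ℝ public using (_∋_)

∋∌⇒< : ∀ x {p q} → x ∋ p → ¬ x ∋ q → p ℚ.< q
∋∌⇒< x {p} {q} x∋p x∌q with ℚ.<-cmp p q
... | tri< p<q _ _  = p<q
... | tri≈ _ refl _ = contradiction x∋p x∌q
... | tri> _ _ q<p  = contradiction (ℝ.closed x q<p x∋p) x∌q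

infix 4 _≤_ _<_

_≤_ : ℝ → ℝ → Set
x ≤ y = ∀ q → x ∋ q → y ∋ q

_<_ : ℝ → ℝ → Set
x < y = ∃[ q ] (¬ x ∋ q × y ∋ q)

⟦_⟧ : ℚ → ℝ
⟦ p ⟧ = record
  { _∋_       = ℚ._< p
  ; inhabited = p ℚ.- 1ℚ , p-1<p p
  ; bounded   = p , ℚ.<-irrefl refl
  ; closed    = ℚ.<-trans
  ; rounded   = λ q<p → let m , q<m , m<p = ℚ.<-dense q<p in m , q<m , m<p
  }

0ℝ 1ℝ : ℝ
0ℝ = ⟦ 0ℚ ⟧
1ℝ = ⟦ 1ℚ ⟧

infixl 6 _+_
infixl 7 _*_
infix  8 -_ 2^_ 2^-_

_+_ : ℝ → ℝ → ℝ
x + y = record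
  { _∋_       = λ q → ∃[ r ] ∃[ t ] (x ∋ r × y ∋ t × q ℚ.≤ r ℚ.+ t)
  ; inhabited = let r , x∋r = ℝ.inhabited x ; t , y∋t = ℝ.inhabited y
                in r ℚ.+ t , r , t , x∋r , y∋t , ℚ.≤-refl
  ; bounded   = let a , x∌a = ℝ.bounded x ; b , y∌b = ℝ.bounded y
                in a ℚ.+ b , λ (r , t , x∋r , y∋t , a+b≤r+t) →
                   ℚ.<-irrefl refl (ℚ.<-≤-trans
                     (ℚ.+-mono-< (∋∌⇒< x x∋r x∌a) (∋∌⇒< y y∋t y∌b)) a+b≤r+t)
  ; closed    = λ p<q (r , t , x∋r , y∋t , q≤r+t) →
                r , t , x∋r , y∋t , ℚ.≤-trans (ℚ.<⇒≤ p<q) q≤r+t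
  ; rounded   = λ (r , t , x∋r , y∋t , q≤r+t) →
                let r′ , r<r′ , x∋r′ = ℝ.rounded x x∋r
                in r′ ℚ.+ t , ℚ.≤-<-trans q≤r+t (ℚ.+-monoˡ-< t r<r′)
                 , r′ , t , x∋r′ , y∋t , ℚ.≤-refl
  }

-- q < - x iff some rational q′ > q satisfies x ≤ - q′.
-_ : ℝ → ℝ
- x = record
  { _∋_       = λ q → ∃[ q′ ] (q ℚ.< q′ × ¬ x ∋ (ℚ.- q′))
  ; inhabited = let b , x∌b = ℝ.bounded x
                in ℚ.- b ℚ.- 1ℚ , ℚ.- b , p-1<p (ℚ.- b)
                 , subst (λ z → ¬ x ∋ z) (sym (neg-involutive b)) x∌b
  ; bounded   = let a , x∋a = ℝ.inhabited x
                in ℚ.- a , λ (q′ , -a<q′ , x∌-q′) → x∌-q′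
                   (ℝ.closed x (subst (ℚ.- q′ ℚ.<_) (neg-involutive a)
                                 (ℚ.neg-antimono-< -a<q′)) x∋a)
  ; closed    = λ p<q (q′ , q<q′ , x∌-q′) → q′ , ℚ.<-trans p<q q<q′ , x∌-q′
  ; rounded   = λ (q′ , q<q′ , x∌-q′) →
                let m , q<m , m<q′ = ℚ.<-dense q<q′
                in m , q<m , q′ , m<q′ , x∌-q′
  }

-- 2 ^ x = sup { 2 ^ r | r ∈ ℚ , r < x }.  For r = i / k in lowest terms and
-- q ≥ 0, the condition q ≤ 2 ^ r reads q ^ k ≤ 2 ^ i.
2^_ : ℝ → ℝ
2^ x = record
  { _∋_       = λ q → ∃[ q′ ] ∃[ r ]
                  (q ℚ.< q′ × 0ℚ ℚ.≤ q′ × x ∋ r × q′ ^ℚ ↧ₙ r ℚ.≤ 2^ℤ (↥ r))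
  ; inhabited = let r , x∋r = ℝ.inhabited x
                in 0ℚ ℚ.- 1ℚ , 0ℚ , r , p-1<p 0ℚ , ℚ.≤-refl , x∋r
                 , ℚ.≤-trans (0^≤0 (ℚ.ℚ.denominator-1 r)) (0≤2^ℤ (↥ r))
  ; bounded   = let b , x∌b = ℝ.bounded x ; n = ℤ.∣ ↥ b ∣
                in 2ℚ ^ℚ n , λ (q′ , r , 2^n<q′ , _ , x∋r , q′^k≤2^i) →
                   ℚ.<-irrefl refl (ℚ.<-≤-trans
                     (ℚ.<-≤-trans
                       (^-mono-< (0≤p^n 0≤2 n) 2^n<q′ (ℚ.ℚ.denominator-1 r))
                       q′^k≤2^i)
                     (subst (2^ℤ (↥ r) ℚ.≤_)
                       (sym (Exp.^-assocʳ ℚ-semiring 2ℚ n (↧ₙ r)))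
                       (2^ℤ≤2^ (↥ r) (↥r≤∣↥b∣*↧r {r} {b} (∋∌⇒< x x∋r x∌b)))))
  ; closed    = λ p<q (q′ , r , q<q′ , rest) →
                q′ , r , ℚ.<-trans p<q q<q′ , rest
  ; rounded   = λ (q′ , r , q<q′ , rest) →
                let m , q<m , m<q′ = ℚ.<-dense q<q′
                in m , q<m , q′ , r , m<q′ , rest
  }

-- The half-line [0,∞).
record ℝ≥0 : Set₁ where
  constructor mkℝ≥0
  field
    real   : ℝ
    nonneg : 0ℝ ≤ real

open ℝ≥0 public using (real)

_*_ : ℝ≥0 → ℝ≥0 → ℝ≥0
mkℝ≥0 x 0≤x * mkℝ≥0 y 0≤y = mkℝ≥0 z (λ _ → inj₁)
  where
  Below : ℚ → Set
  Below q = q ℚ.< 0ℚ ⊎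
    ∃[ r ] ∃[ t ] (0ℚ ℚ.≤ r × 0ℚ ℚ.≤ t × x ∋ r × y ∋ t × q ℚ.≤ r ℚ.* t)

  bounded′ : ∃[ q ] ¬ Below q
  bounded′ with ℝ.bounded x | ℝ.bounded y
  ... | a , x∌a | b , y∌b = a ℚ.* b , λ where
    (inj₁ ab<0) → ℚ.<-irrefl refl (ℚ.<-≤-trans ab<0
      (0≤p*q (ℚ.≮⇒≥ λ a<0 → x∌a (0≤x a a<0)) (ℚ.≮⇒≥ λ b<0 → y∌b (0≤y b b<0))))
    (inj₂ (r , t , 0≤r , 0≤t , x∋r , y∋t , ab≤rt)) →
      ℚ.<-irrefl refl (ℚ.<-≤-trans
        (*-mono-<-nn 0≤r 0≤t (∋∌⇒< x x∋r x∌a) (∋∌⇒< y y∋t y∌b)) ab≤rt)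

  closed′ : ∀ {p q} → p ℚ.< q → Below q → Below p
  closed′ p<q (inj₁ q<0) = inj₁ (ℚ.<-trans p<q q<0)
  closed′ p<q (inj₂ (r , t , 0≤r , 0≤t , x∋r , y∋t , q≤rt)) =
    inj₂ (r , t , 0≤r , 0≤t , x∋r , y∋t , ℚ.≤-trans (ℚ.<⇒≤ p<q) q≤rt)

  rounded′ : ∀ {p} → Below p → ∃[ q ] (p ℚ.< q × Below q)
  rounded′ (inj₁ p<0) with ℚ.<-dense p<0
  ... | m , p<m , m<0 = m , p<m , inj₁ m<0
  rounded′ (inj₂ (r , t , 0≤r , 0≤t , x∋r , y∋t , p≤rt))
    with ℝ.rounded x x∋r | ℝ.rounded y y∋t
  ... | r′ , r<r′ , x∋r′ | t′ , t<t′ , y∋t′ =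
    r′ ℚ.* t′ , ℚ.≤-<-trans p≤rt (*-mono-<-nn 0≤r 0≤t r<r′ t<t′)
    , inj₂ (r′ , t′ , ℚ.≤-trans 0≤r (ℚ.<⇒≤ r<r′) , ℚ.≤-trans 0≤t (ℚ.<⇒≤ t<t′)
           , x∋r′ , y∋t′ , ℚ.≤-refl)

  z : ℝ
  z = record
    { _∋_       = Below
    ; inhabited = 0ℚ ℚ.- 1ℚ , inj₁ (p-1<p 0ℚ)
    ; bounded   = bounded′
    ; closed    = closed′
    ; rounded   = rounded′
    }

0≤2^ : ∀ x → 0ℝ ≤ 2^ x
0≤2^ x q q<0 = let r , x∋r = ℝ.inhabited x
  in 0ℚ , r , q<0 , ℚ.≤-refl , x∋r
   , ℚ.≤-trans (0^≤0 (ℚ.ℚ.denominator-1 r)) (0≤2^ℤ (↥ r))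

infixl 6 _+₀_
_+₀_ : ℝ≥0 → ℝ≥0 → ℝ≥0
mkℝ≥0 x 0≤x +₀ mkℝ≥0 y 0≤y = mkℝ≥0 (x + y) 0≤x+y
  where
  0≤x+y : 0ℝ ≤ x + y
  0≤x+y q q<0 =
    q ℚ.* ½ , q ℚ.* ½ , 0≤x _ q/2<0 , 0≤y _ q/2<0 , ℚ.≤-reflexive (halves q)
    where
    q/2<0 : q ℚ.* ½ ℚ.< 0ℚ
    q/2<0 = ℚ.*-monoˡ-<-pos ½ q<0

2^-_ : ℝ≥0 → ℝ≥0
2^- s = mkℝ≥0 (2^ (- real s)) (0≤2^ (- real s))

-- Convergence of a rational sequence to a real: |u n - x| < ε eventually.
_⟶_ : (ℕ → ℚ) → ℝ → Set
u ⟶ x = ∀ ε → 0ℚ ℚ.< ε → ∃[ N ] ∀ n → N ℕ.≤ n →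
  (⟦ u n ℚ.- ε ⟧ < x) × (x < ⟦ u n ℚ.+ ε ⟧)

IsInfimum : (ℝ≥0 → Set₁) → ℝ → Set₁
IsInfimum A x =
  (∀ s → A s → x ≤ real s) × (∀ y → (∀ s → A s → y ≤ real s) → y ≤ x)

------------------------------------------------------------------------
-- Computability

-- Codes for the μ-recursive partial functions ℕⁿ ⇀ ℕ.
data Rec : ℕ → Set where
  zer  : ∀ {n} → Rec n
  succ : Rec 1
  proj : ∀ {n} → Fin n → Rec n
  comp : ∀ {m n} → Rec m → Vec (Rec n) m → Rec n
  prec : ∀ {n} → Rec n → Rec (2 ℕ.+ n) → Rec (1 ℕ.+ n)
  min  : ∀ {n} → Rec (1 ℕ.+ n) → Rec n

-- f [ xs ]⇓ y: the function coded by f is defined at xs with value y.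
infix 4 _[_]⇓_
data _[_]⇓_ : ∀ {n} → Rec n → Vec ℕ n → ℕ → Set where
  ⇓zero : ∀ {n} {xs : Vec ℕ n} → zer [ xs ]⇓ 0
  ⇓suc  : ∀ {x} → succ [ x ∷ [] ]⇓ suc x
  ⇓proj : ∀ {n} {xs : Vec ℕ n} i → proj i [ xs ]⇓ lookup xs i
  ⇓comp : ∀ {m n} {f : Rec m} {gs : Vec (Rec n) m} {xs ys z} →
          Pointwise (λ g y → g [ xs ]⇓ y) gs ys → f [ ys ]⇓ z →
          comp f gs [ xs ]⇓ z
  ⇓prec-zero : ∀ {n} {f : Rec n} {g xs y} →
          f [ xs ]⇓ y → prec f g [ 0 ∷ xs ]⇓ y
  ⇓prec-suc  : ∀ {n} {f : Rec n} {g k xs y z} →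
          prec f g [ k ∷ xs ]⇓ y → g [ k ∷ y ∷ xs ]⇓ z →
          prec f g [ suc k ∷ xs ]⇓ z
  ⇓min  : ∀ {n} {f : Rec (1 ℕ.+ n)} {xs k} →
          (∀ i → i ℕ.< k → ∃[ y ] f [ i ∷ xs ]⇓ suc y) → f [ k ∷ xs ]⇓ 0 →
          min f [ xs ]⇓ k

String : Set
String = List Bool

-- The bijection {0,1}* → ℕ given by bijective base-2 numeration.
encode : String → ℕ
encode []          = 0
encode (false ∷ w) = 1 ℕ.+ 2 ℕ.* encode w
encode (true  ∷ w) = 2 ℕ.+ 2 ℕ.* encode w

Computableℕ : (String → ℕ → ℕ) → Set
Computableℕ f = Σ[ c ∈ Rec 2 ] ∀ w t → c [ encode w ∷ t ∷ [] ]⇓ f w t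

-- A rational is output as a triple (a , b , c) representing (a - b) / (c + 1).
Computableℚ : (String → ℕ → ℚ) → Set
Computableℚ f = ∃[ a ] ∃[ b ] ∃[ c ]
  (Computableℕ a × Computableℕ b × Computableℕ c ×
   (∀ w t → f w t ≡ (a w t ℤ.⊖ b w t) ℚ./ suc (c w t)))

LowerSemicomputable : (String → ℝ) → Set
LowerSemicomputable f = Σ[ f̂ ∈ (String → ℕ → ℚ) ]
  (Computableℚ f̂ ×
   (∀ w t → f̂ w t ℚ.≤ f̂ w (suc t) × ⟦ f̂ w (suc t) ⟧ < f w) ×
   (∀ w → f̂ w ⟶ f w))

------------------------------------------------------------------------
-- Supergales and constructive dimension

Cantor : Set
Cantor = ℕ → Bool

prefix : Cantor → ℕ → String
prefix S n = applyUpTo S n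

IsSupergale : ℝ≥0 → (String → ℝ≥0) → Set
IsSupergale s d =
  ∀ w → real (2^- s * (d (w ∷ʳ false) +₀ d (w ∷ʳ true))) ≤ real (d w)

Constructive : (String → ℝ≥0) → Set
Constructive d = LowerSemicomputable (λ w → real (d w))

-- limsup d(S[0..n-1]) = ∞.
SucceedsOn : (String → ℝ≥0) → Cantor → Set₁
SucceedsOn d S =
  ∀ (M : ℝ) (N : ℕ) → ∃[ n ] (N ℕ.≤ n × M < real (d (prefix S n)))

S^∞[_] : (String → ℝ≥0) → Cantor → Set₁
S^∞[ d ] S = SucceedsOn d S

HasCdim : (Cantor → Set) → ℝ → Set₁
HasCdim X = IsInfimum λ s → Σ[ d ∈ (String → ℝ≥0) ]
  (IsSupergale s d × Constructive d × (∀ S → X S → S^∞[ d ] S))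

-- Sequences are compared pointwise, as function extensionality is not assumed.
｛_｝ : Cantor → Cantor → Set
｛ S ｝ T = S ≗ T

HasDim : Cantor → ℝ → Set₁
HasDim S = HasCdim ｛ S ｝

{-# OPTIONS --safe #-}
-- Let θ be van der Corput's equidistributed sequence and A = { n | θ(n) < α }.
-- The sequence S has zeros outside A; the bits in A are chosen so that, for all
-- constructive supergales d at once, a suitably weighted sum of the values
-- 2 ^ (- s n) d(S[0..n-1]) is halved at each bit in A and does not grow at the
-- others.  As A has density α, d cannot succeed on S when s < α.  For s > α take a
-- dyadic γ between α and s: the set { n | θ(n) < γ } is computable, contains A and
-- has density γ, so an s-supergale betting on zeros outside it succeeds on S.
module Submission where

open import Defs
open ℚ-Lemmas
open import Algebra.Bundles using (CommutativeRing)
import Algebra.Properties.CommutativeSemiring.Exp as CommutativeExp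
import Algebra.Properties.Semiring.Exp as Exp
open import Axiom.ExcludedMiddle using (ExcludedMiddle)
open import Data.Bool.Base using (Bool; true; false; not; if_then_else_; T)
open import Data.Fin.Base as Fin using (Fin; zero; suc)
open import Data.Fin.Patterns using (0F; 1F; 2F)
open import Data.Integer.Base as ℤ using (+_; -[1+_])
import Data.Integer.Properties as ℤ
open import Data.List.Base using (List; []; _∷_; _++_; _∷ʳ_; length)
import Data.List.Properties as List
open import Data.Nat.Base as ℕ using (ℕ; zero; suc; pred; z≤n; s≤s)
import Data.Nat.Coprimality as Coprime
import Data.Nat.DivMod as ℕ
import Data.Nat.Properties as ℕ
open import Data.Product.Base using (Σ-syntax; ∃-syntax; _×_; _,_; proj₁; proj₂)
open import Data.Rational.Base as ℚ using (ℚ; mkℚ; 0ℚ; 1ℚ; ½; ↥_; ↧ₙ_)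
import Data.Rational.Properties as ℚ
open import Data.Rational.Solver using (module +-*-Solver)
import Data.Rational.Unnormalised.Base as ℚᵘ
import Data.Rational.Unnormalised.Properties as ℚᵘ
open import Data.Sum.Base using (_⊎_; inj₁; inj₂)
open import Data.Unit.Base using (tt)
open import Data.Vec.Base using (Vec; []; _∷_; lookup; head; tail)
open import Data.Vec.Relation.Binary.Pointwise.Inductive using (Pointwise; []; _∷_)
open import Function.Base using (_∘_)
open import Level using (0ℓ; Lift; lift; lower) renaming (suc to lsuc)
open import Relation.Binary.Definitions using (tri<; tri≈; tri>)
open import Relation.Binary.PropositionalEquality
open import Relation.Nullary using (¬_; Dec; yes; no; contradiction)
open import Relation.Nullary.Decidable
  using (⌊_⌋; toWitness; fromWitness; map′; decidable-stable)

-- Computability of products over the digits of a string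

-- Real exponents give uncountably many opponents. But an s-supergale also satisfies the inequality
-- with any rational factor c < 2^-s, and c, three codes for the approximations and a bound on the
-- initial value are finite data, so countably many records cover all opponents. The price is to fit
-- below 2^-s a rational c for which c ^ (2 ^ k) is still at least 2^-p for some dyadic p / 2^k < α;
-- hence the approximation of powers of 2. The enumeration need not be effective, since S is chosen
-- by excluded middle. Values of supergales remain lower cuts throughout: the weighted sum is never
-- formed as a real number, only finite sums of rationals below its terms are bounded. One bound
-- needs many free bits before every prefix, the other a decidable superset with few. Van der
-- Corput's sequence gives both without limits: the sets for dyadic thresholds are nested and
-- periodic, with an exact count in each period.

⇓-functional : ∀ {n} {f : Rec n} {xs y z} → f [ xs ]⇓ y → f [ xs ]⇓ z → y ≡ z
⇓-functionalᵛ : ∀ {m n} {fs : Vec (Rec n) m} {xs ys zs} →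
  Pointwise (λ f y → f [ xs ]⇓ y) fs ys →
  Pointwise (λ f y → f [ xs ]⇓ y) fs zs → ys ≡ zs

⇓-functional ⇓zero ⇓zero = refl
⇓-functional ⇓suc ⇓suc = refl
⇓-functional (⇓proj i) (⇓proj .i) = refl
⇓-functional (⇓comp gs f) (⇓comp gs′ f′) with ⇓-functionalᵛ gs gs′
... | refl = ⇓-functional f f′
⇓-functional (⇓prec-zero f) (⇓prec-zero f′) = ⇓-functional f f′
⇓-functional (⇓prec-suc r g) (⇓prec-suc r′ g′) with ⇓-functional r r′
... | refl = ⇓-functional g g′
⇓-functional (⇓min {k = k} below f) (⇓min {k = l} below′ f′) with ℕ.<-cmp k l
... | tri≈ _ k≡l _ = k≡l
... | tri< k<l _ _ with ⇓-functional f (proj₂ (below′ k k<l))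
...   | ()
⇓-functional (⇓min {k = k} below f) (⇓min {k = l} below′ f′)
    | tri> _ _ l<k with ⇓-functional (proj₂ (below l l<k)) f′
...   | ()

⇓-functionalᵛ [] [] = refl
⇓-functionalᵛ (f ∷ fs) (f′ ∷ fs′) =
  cong₂ _∷_ (⇓-functional f f′) (⇓-functionalᵛ fs fs′)

-- Closure properties of the total computable functions

Computable : ∀ {n} → (Vec ℕ n → ℕ) → Set
Computable {n} f = Σ[ c ∈ Rec n ] ∀ xs → c [ xs ]⇓ f xs

Computable₁ : (ℕ → ℕ) → Set
Computable₁ g = Computable {1} λ xs → g (lookup xs 0F)

Computable₂ : (ℕ → ℕ → ℕ) → Set
Computable₂ g = Computable {2} λ xs → g (lookup xs 0F) (lookup xs 1F)

module _ {n : ℕ} where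

  var : ∀ i → Computable {n} λ xs → lookup xs i
  var i = proj i , λ _ → ⇓proj i

  app₁ : ∀ {g f} → Computable₁ g → Computable {n} f → Computable λ xs → g (f xs)
  app₁ (cg , ⇓g) (cf , ⇓f) =
    comp cg (cf ∷ []) , λ xs → ⇓comp (⇓f xs ∷ []) (⇓g _)

  app₂ : ∀ {g f f′} → Computable₂ g → Computable {n} f → Computable {n} f′ →
         Computable λ xs → g (f xs) (f′ xs)
  app₂ (cg , ⇓g) (cf , ⇓f) (cf′ , ⇓f′) =
    comp cg (cf ∷ cf′ ∷ []) , λ xs → ⇓comp (⇓f xs ∷ ⇓f′ xs ∷ []) (⇓g _)

  app₃ : ∀ {g : ℕ → ℕ → ℕ → ℕ} {f₁ f₂ f₃} →
         Computable {3} (λ xs → g (lookup xs 0F) (lookup xs 1F) (lookup xs 2F)) →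
         Computable {n} f₁ → Computable {n} f₂ → Computable {n} f₃ →
         Computable λ xs → g (f₁ xs) (f₂ xs) (f₃ xs)
  app₃ (cg , ⇓g) (c₁ , ⇓₁) (c₂ , ⇓₂) (c₃ , ⇓₃) =
    comp cg (c₁ ∷ c₂ ∷ c₃ ∷ []) , λ xs → ⇓comp (⇓₁ xs ∷ ⇓₂ xs ∷ ⇓₃ xs ∷ []) (⇓g _)

  suc-computable : ∀ {f} → Computable {n} f → Computable λ xs → suc (f xs)
  suc-computable (c , ⇓f) = comp succ (c ∷ []) , λ xs → ⇓comp (⇓f xs ∷ []) ⇓suc

  const-computable : ∀ k → Computable {n} λ _ → k
  const-computable zero    = zer , λ _ → ⇓zero
  const-computable (suc k) = suc-computable (const-computable k)

  prec-computable : ∀ {h : ℕ → Vec ℕ n → ℕ} {g} →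
    Computable (h 0) → Computable {2 ℕ.+ n} g →
    (∀ k xs → h (suc k) xs ≡ g (k ∷ h k xs ∷ xs)) →
    Computable {1 ℕ.+ n} λ xs → h (head xs) (tail xs)
  prec-computable {h} (c₀ , ⇓₀) (c₁ , ⇓₁) h-suc =
    prec c₀ c₁ , λ { (k ∷ xs) → go k xs }
    where
    go : ∀ k xs → prec c₀ c₁ [ k ∷ xs ]⇓ h k xs
    go zero    xs = ⇓prec-zero (⇓₀ xs)
    go (suc k) xs = subst (prec c₀ c₁ [ suc k ∷ xs ]⇓_) (sym (h-suc k xs))
      (⇓prec-suc (go k xs) (⇓₁ (k ∷ h k xs ∷ xs)))

cast : ∀ {n} {f g : Vec ℕ n → ℕ} → Computable f → f ≗ g → Computable g
cast (c , ⇓f) f≗g = c , λ xs → subst (c [ xs ]⇓_) (f≗g xs) (⇓f xs)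

prec-computable₂ : ∀ {h : ℕ → ℕ → ℕ} {g} →
  Computable₁ (h 0) → Computable {3} g →
  (∀ k x → h (suc k) x ≡ g (k ∷ h k x ∷ x ∷ [])) →
  Computable₂ h
prec-computable₂ {h} c₀ c₁ h-suc = cast
  (prec-computable {h = λ k xs → h k (lookup xs 0F)} c₀ c₁
    λ { k (x ∷ []) → h-suc k x })
  λ { (k ∷ x ∷ []) → refl }

+-computable : ∀ {n} {f g : Vec ℕ n → ℕ} →
  Computable f → Computable g → Computable λ xs → f xs ℕ.+ g xs
+-computable = app₂ {g = ℕ._+_}
  (prec-computable₂ {h = ℕ._+_} (var 0F) (suc-computable (var 1F)) λ _ _ → refl)

*-computable : ∀ {n} {f g : Vec ℕ n → ℕ} →
  Computable f → Computable g → Computable λ xs → f xs ℕ.* g xs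
*-computable = app₂ {g = ℕ._*_}
  (prec-computable₂ {h = ℕ._*_} (const-computable 0) (+-computable (var 2F) (var 1F)) λ _ _ → refl)

pred-computable : ∀ {n} {f : Vec ℕ n → ℕ} → Computable f → Computable λ xs → pred (f xs)
pred-computable = app₁ {g = pred} (cast
  (prec-computable {h = λ k _ → pred k} (const-computable 0) (var 0F) λ _ _ → refl)
  λ { (_ ∷ []) → refl })

toℕ : Bool → ℕ
toℕ b = if b then 1 else 0

Decidable : ∀ {n} → (Vec ℕ n → Bool) → Set
Decidable p = Computable λ xs → toℕ (p xs)

if-computable : ∀ {n p} {f g : Vec ℕ n → ℕ} →
  Decidable p → Computable f → Computable g → Computable λ xs → if p xs then f xs else g xs
if-computable {p = p} cp cf cg = cast
  (app₃ {g = cond}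
    (cast (prec-computable {h = λ k xs → cond k (lookup xs 0F) (lookup xs 1F)}
             (var 1F) (var 2F) λ { _ (_ ∷ _ ∷ []) → refl })
          λ { (_ ∷ _ ∷ _ ∷ []) → refl })
    cp cf cg)
  λ xs → cond-toℕ (p xs)
  where
  cond : ℕ → ℕ → ℕ → ℕ
  cond zero    x y = y
  cond (suc _) x y = x
  cond-toℕ : ∀ b {x y} → cond (toℕ b) x y ≡ (if b then x else y)
  cond-toℕ false = refl
  cond-toℕ true  = refl

not-decidable : ∀ {n} {p : Vec ℕ n → Bool} → Decidable p → Decidable λ xs → not (p xs)
not-decidable {p = p} cp = cast
  (if-computable cp (const-computable 0) (const-computable 1)) λ xs → toℕ-not (p xs)
  where
  toℕ-not : ∀ b → (if b then 0 else 1) ≡ toℕ (not b)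
  toℕ-not false = refl
  toℕ-not true  = refl

nonzero : ℕ → Bool
nonzero zero    = false
nonzero (suc _) = true

nonzero-decidable : ∀ {n} {f : Vec ℕ n → ℕ} → Computable f → Decidable λ xs → nonzero (f xs)
nonzero-decidable = app₁ {g = λ n → toℕ (nonzero n)} (cast
  (prec-computable {h = λ k _ → toℕ (nonzero k)} (const-computable 0) (const-computable 1)
    λ _ _ → refl)
  λ { (_ ∷ []) → refl })

odd : ℕ → Bool
odd zero    = false
odd (suc n) = not (odd n)

half : ℕ → ℕ
half zero    = 0
half (suc n) = if odd n then suc (half n) else half n

odd-decidable : ∀ {n} {f : Vec ℕ n → ℕ} → Computable f → Decidable λ xs → odd (f xs)
odd-decidable = app₁ {g = λ n → toℕ (odd n)} (cast
  (prec-computable {h = λ k _ → toℕ (odd k)} (const-computable 0) step h-suc)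
  λ { (_ ∷ []) → refl })
  where
  step : Computable {2} λ xs → toℕ (not (nonzero (lookup xs 1F)))
  step = not-decidable (nonzero-decidable (var 1F))
  h-suc : ∀ k (xs : Vec ℕ 0) → toℕ (odd (suc k)) ≡ toℕ (not (nonzero (toℕ (odd k))))
  h-suc k _ with odd k
  ... | false = refl
  ... | true  = refl

half-computable : ∀ {n} {f : Vec ℕ n → ℕ} → Computable f → Computable λ xs → half (f xs)
half-computable = app₁ {g = half} (cast
  (prec-computable {h = λ k _ → half k} (const-computable 0)
    (if-computable (odd-decidable (var 0F)) (suc-computable (var 1F)) (var 1F)) λ _ _ → refl)
  λ { (_ ∷ []) → refl })

odd-2* : ∀ n → odd (2 ℕ.* n) ≡ false
odd-2* zero = refl
odd-2* (suc n) rewrite ℕ.+-suc n (n ℕ.+ 0) | odd-2* n = refl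

half-2* : ∀ n → half (2 ℕ.* n) ≡ n
half-1+2* : ∀ n → half (1 ℕ.+ 2 ℕ.* n) ≡ n
half-1+2* n rewrite odd-2* n = half-2* n
half-2* zero = refl
half-2* (suc n) rewrite ℕ.+-suc n (n ℕ.+ 0) | odd-2* n = cong suc (half-2* n)

-- `half` after `pred` inverts both `1 + 2 * e` and `2 + 2 * e`, so on the code of w this yields the
-- code of w without its first n digits.
tailCode : ℕ → ℕ → ℕ
tailCode zero    e = e
tailCode (suc n) e = half (pred (tailCode n e))

tailCode-computable : Computable₂ tailCode
tailCode-computable = prec-computable₂ {h = tailCode}
  (var 0F) (half-computable (pred-computable (var 1F))) λ _ _ → refl

tailCode-suc : ∀ n e → tailCode (suc n) e ≡ tailCode n (half (pred e))
tailCode-suc zero    e = refl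
tailCode-suc (suc n) e = cong (λ x → half (pred x)) (tailCode-suc n e)

tailCode-∷ : ∀ n b w → tailCode (suc n) (encode (b ∷ w)) ≡ tailCode n (encode w)
tailCode-∷ n b w = trans (tailCode-suc n _) (cong (tailCode n) (half-pred b))
  where
  half-pred : ∀ b → half (pred (encode (b ∷ w))) ≡ encode w
  half-pred false = half-2* (encode w)
  half-pred true  = half-1+2* (encode w)

-- The code of a nonempty string is odd if the string starts with `false` and even if it starts with
-- `true`. Code 0, reached past the end of the string, gives the neutral factor.
factor : (ℕ → Bool → ℕ) → ℕ → ℕ → ℕ
factor f n e = if nonzero e then f n (not (odd e)) else 1

factor-∷ : ∀ f n b w → factor f n (encode (b ∷ w)) ≡ f n b
factor-∷ f n false w rewrite odd-2* (encode w) = refl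
factor-∷ f n true  w rewrite odd-2* (encode w) = refl

codeProduct : (ℕ → Bool → ℕ) → ℕ → ℕ → ℕ
codeProduct f zero    e = 1
codeProduct f (suc n) e = factor f n (tailCode n e) ℕ.* codeProduct f n e

product : (ℕ → Bool → ℕ) → String → ℕ
product f []      = 1
product f (b ∷ w) = f 0 b ℕ.* product (f ∘ suc) w

-- Primitive recursion on the number of rounds adds factors at the last position, while `product`
-- peels them off at the first; this lemma mediates.
codeProduct-∷ : ∀ f n b w →
  codeProduct f (suc n) (encode (b ∷ w)) ≡ f 0 b ℕ.* codeProduct (f ∘ suc) n (encode w)
codeProduct-∷ f zero    b w = cong (ℕ._* 1) (factor-∷ f 0 b w)
codeProduct-∷ f (suc n) b w = begin
  factor f (suc n) (tailCode (suc n) (encode (b ∷ w))) ℕ.* codeProduct f (suc n) (encode (b ∷ w))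
    ≡⟨ cong₂ ℕ._*_ (cong (factor f (suc n)) (tailCode-∷ n b w)) (codeProduct-∷ f n b w) ⟩
  x ℕ.* (f 0 b ℕ.* y)
    ≡⟨ ℕ.*-assoc x (f 0 b) y ⟨
  x ℕ.* f 0 b ℕ.* y
    ≡⟨ cong (ℕ._* y) (ℕ.*-comm x (f 0 b)) ⟩
  f 0 b ℕ.* x ℕ.* y
    ≡⟨ ℕ.*-assoc (f 0 b) x y ⟩
  f 0 b ℕ.* (x ℕ.* y) ∎
  where
  open ≡-Reasoning
  x = factor f (suc n) (tailCode n (encode w))
  y = codeProduct (f ∘ suc) n (encode w)

tailCode-0 : ∀ n → tailCode n 0 ≡ 0
tailCode-0 zero    = refl
tailCode-0 (suc n) rewrite tailCode-0 n = refl

codeProduct-[] : ∀ f n → codeProduct f n 0 ≡ 1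
codeProduct-[] f zero = refl
codeProduct-[] f (suc n) rewrite tailCode-0 n | codeProduct-[] f n = refl

-- Rounds past the end of w multiply by 1, so any bound on the length will do. The code of w is one,
-- which spares computing the length.
codeProduct-encode : ∀ f n w → length w ℕ.≤ n → codeProduct f n (encode w) ≡ product f w
codeProduct-encode f n       []      _         = codeProduct-[] f n
codeProduct-encode f (suc n) (b ∷ w) (s≤s ∣w∣≤n) = trans (codeProduct-∷ f n b w)
  (cong (f 0 b ℕ.*_) (codeProduct-encode (f ∘ suc) n w ∣w∣≤n))

length≤encode : ∀ w → length w ℕ.≤ encode w
length≤encode []          = z≤n
length≤encode (false ∷ w) = s≤s (ℕ.≤-trans (length≤encode w) (ℕ.m≤m+n _ _))
length≤encode (true ∷ w)  = s≤s (ℕ.m≤n⇒m≤1+n (ℕ.≤-trans (length≤encode w) (ℕ.m≤m+n _ _)))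

codeProduct-computable : ∀ f →
  Computable {2} (λ xs → f (lookup xs 0F) (not (odd (lookup xs 1F)))) →
  Computable₁ λ e → codeProduct f e e
codeProduct-computable f cf = app₂ {g = codeProduct f}
  (prec-computable₂ {h = codeProduct f} (const-computable 1)
    (*-computable
      (app₂ {g = factor f}
        (if-computable (nonzero-decidable (var 1F)) cf (const-computable 1))
        (var 0F) (app₂ {g = tailCode} tailCode-computable (var 0F) (var 2F)))
      (var 1F))
    λ _ _ → refl)
  (var 0F) (var 0F)

codeProduct≡product : ∀ f w → codeProduct f (encode w) (encode w) ≡ product f w
codeProduct≡product f w = codeProduct-encode f (encode w) w (length≤encode w)

computableℕ : ∀ {g f} → Computable {2} g → (∀ w t → g (encode w ∷ t ∷ []) ≡ f w t) →
  Computableℕ f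
computableℕ (c , ⇓g) g≡f = c , λ w t → subst (c [ encode w ∷ t ∷ [] ]⇓_) (g≡f w t) (⇓g _)

-- An enumeration of the codes

-- Codes of all arities, vectors of codes and numbers are laid out in one untyped kind of tree, so
-- that a single enumeration serves for all of them.
infixr 6 _·_
data Tree : Set where
  leaf : Tree
  _·_  : Tree → Tree → Tree

increment : String → String
increment []          = false ∷ []
increment (false ∷ w) = true ∷ w
increment (true ∷ w)  = false ∷ increment w

numeral : ℕ → String
numeral zero    = []
numeral (suc n) = increment (numeral n)

numeral-odd : ∀ n → numeral (1 ℕ.+ 2 ℕ.* n) ≡ false ∷ numeral n
numeral-odd zero = refl
numeral-odd (suc n) rewrite ℕ.+-suc n (n ℕ.+ 0) | numeral-odd n = refl

numeral-encode : ∀ w → numeral (encode w) ≡ w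
numeral-encode []          = refl
numeral-encode (false ∷ w) =
  trans (numeral-odd (encode w)) (cong (false ∷_) (numeral-encode w))
numeral-encode (true ∷ w)  =
  trans (cong increment (numeral-odd (encode w))) (cong (true ∷_) (numeral-encode w))

-- Strings are read as programs of a stack machine: false pushes a leaf and
-- true joins the two topmost trees.
run : String → List Tree → List Tree
run []          ts           = ts
run (false ∷ w) ts           = run w (leaf ∷ ts)
run (true ∷ w)  (t ∷ u ∷ ts) = run w (u · t ∷ ts)
run (true ∷ w)  ts           = ts

postfix : Tree → String
postfix leaf    = false ∷ []
postfix (t · u) = postfix t ++ postfix u ++ true ∷ []

run-postfix : ∀ t w ts → run (postfix t ++ w) ts ≡ run w (t ∷ ts)
run-postfix leaf    w ts = refl
run-postfix (t · u) w ts = begin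
  run ((postfix t ++ postfix u ++ true ∷ []) ++ w) ts
    ≡⟨ cong (λ v → run v ts) (List.++-assoc (postfix t) _ w) ⟩
  run (postfix t ++ (postfix u ++ true ∷ []) ++ w) ts
    ≡⟨ run-postfix t _ ts ⟩
  run ((postfix u ++ true ∷ []) ++ w) (t ∷ ts)
    ≡⟨ cong (λ v → run v (t ∷ ts)) (List.++-assoc (postfix u) _ w) ⟩
  run (postfix u ++ true ∷ w) (t ∷ ts)
    ≡⟨ run-postfix u _ (t ∷ ts) ⟩
  run w (t · u ∷ ts) ∎
  where open ≡-Reasoning

top : List Tree → Tree
top []      = leaf
top (t ∷ _) = t

tree : ℕ → Tree
tree n = top (run (numeral n) [])

tree-surjective : ∀ t → ∃[ n ] tree n ≡ t
tree-surjective t = encode (postfix t) , cong top (begin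
  run (numeral (encode (postfix t))) [] ≡⟨ cong (λ w → run w []) (numeral-encode (postfix t)) ⟩
  run (postfix t) []                    ≡⟨ cong (λ w → run w []) (List.++-identityʳ (postfix t)) ⟨
  run (postfix t ++ []) []              ≡⟨ run-postfix t [] [] ⟩
  t ∷ []                                ∎)
  where open ≡-Reasoning

left right : Tree → Tree
left leaf     = leaf
left (t · _)  = t
right leaf    = leaf
right (_ · t) = t

treeℕ : Tree → ℕ
treeℕ leaf    = 0
treeℕ (_ · t) = suc (treeℕ t)

treeℕ-surjective : ∀ n → ∃[ t ] treeℕ t ≡ n
treeℕ-surjective zero    = leaf , refl
treeℕ-surjective (suc n) = let t , t≡n = treeℕ-surjective n in leaf · t , cong suc t≡n

clamp : ∀ n → ℕ → Fin (suc n)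
clamp zero    _       = zero
clamp (suc n) zero    = zero
clamp (suc n) (suc i) = suc (clamp n i)

clamp-toℕ : ∀ n (i : Fin (suc n)) → clamp n (Fin.toℕ i) ≡ i
clamp-toℕ zero    zero    = refl
clamp-toℕ (suc n) zero    = refl
clamp-toℕ (suc n) (suc i) = cong suc (clamp-toℕ n i)

treeBasic : ∀ n → Tree → Rec n
treeBasic 1       leaf    = succ
treeBasic (suc n) (_ · i) = proj (clamp n (treeℕ i))
treeBasic _       _       = zer

-- The arity comes from the context; only the inner arity of `comp` is stored in the tree. Just
-- surjectivity matters, so ill-formed trees may fall back to `zer`.
treeRec  : ∀ n → Tree → Rec n
treeRecs : ∀ n m → Tree → Vec (Rec n) m
treeRec n leaf                                  = zer
treeRec n (leaf · t)                            = treeBasic n t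
treeRec n ((leaf · m) · (f · gs))               =
  comp (treeRec (treeℕ m) f) (treeRecs n (treeℕ m) gs)
treeRec (suc n) (((_ · _) · leaf) · (f · g))    = prec (treeRec n f) (treeRec (2 ℕ.+ n) g)
treeRec n (((_ · _) · (_ · _)) · f)             = min (treeRec (suc n) f)
treeRec _ _                                     = zer
treeRecs n zero    _       = []
treeRecs n (suc m) leaf    = zer ∷ treeRecs n m leaf
treeRecs n (suc m) (t · u) = treeRec n t ∷ treeRecs n m u

treeRec-surjective  : ∀ {n} (c : Rec n) → ∃[ t ] treeRec n t ≡ c
treeRecs-surjective : ∀ {n m} (cs : Vec (Rec n) m) → ∃[ t ] treeRecs n m t ≡ cs
treeRec-surjective zer  = leaf , refl
treeRec-surjective succ = leaf · leaf , refl
treeRec-surjective {suc n} (proj i) with treeℕ-surjective (Fin.toℕ i)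
... | t , t≡i = leaf · leaf · t , trans (basic n) (cong proj (trans (cong (clamp n) t≡i) (clamp-toℕ n i)))
  where
  basic : ∀ n → treeBasic (suc n) (leaf · t) ≡ proj (clamp n (treeℕ t))
  basic zero    = refl
  basic (suc n) = refl
treeRec-surjective (comp {m} f gs) with treeℕ-surjective m
... | u , refl with treeRec-surjective f | treeRecs-surjective gs
...   | t , refl | ts , refl = (leaf · u) · t · ts , refl
treeRec-surjective (prec f g) with treeRec-surjective f | treeRec-surjective g
... | t , refl | u , refl = ((leaf · leaf) · leaf) · t · u , refl
treeRec-surjective {n} (min f) with treeRec-surjective f
... | t , refl = ((leaf · leaf) · leaf · leaf) · t , minEq n
  where
  -- The `prec` clause matches on the arity, so this tree reduces only once the arity is a
  -- constructor.
  minEq : ∀ n {t} → treeRec n (((leaf · leaf) · leaf · leaf) · t) ≡ min (treeRec (suc n) t)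
  minEq zero    = refl
  minEq (suc n) = refl
treeRecs-surjective [] = leaf , refl
treeRecs-surjective (c ∷ cs) with treeRec-surjective c | treeRecs-surjective cs
... | t , refl | ts , refl = t · ts , refl

-- Rational arithmetic

module ℚ^ where
  open Exp ℚ-semiring public using (^-homo-*; ^-assocʳ)
  open CommutativeExp (CommutativeRing.commutativeSemiring ℚ.+-*-commutativeRing) public
    using (^-distrib-*)

private
  variable
    p q : ℚ

-- Built in lowest terms, so that numerator and denominator compute without a gcd.
ι : ℕ → ℚ
ι n = mkℚ (+ n) 0 (Coprime.sym (Coprime.1-coprimeTo n))

ι-+ : ∀ m n → ι (m ℕ.+ n) ≡ ι m ℚ.+ ι n
ι-+ m n = trans (sym (ℚ.↥p/↧p≡p (ι (m ℕ.+ n))))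
  (cong (ℚ._/ 1) (sym (cong₂ ℤ._+_ (ℤ.*-identityʳ (+ m)) (ℤ.*-identityʳ (+ n)))))

ι-* : ∀ m n → ι (m ℕ.* n) ≡ ι m ℚ.* ι n
ι-* m n = trans (sym (ℚ.↥p/↧p≡p (ι (m ℕ.* n)))) (cong (ℚ._/ 1) (ℤ.pos-* m n))

0≤ι : ∀ n → 0ℚ ℚ.≤ ι n
0≤ι n = ℚ.nonNegative⁻¹ (ι n)

ι-mono-≤ : ∀ {m n} → m ℕ.≤ n → ι m ℚ.≤ ι n
ι-mono-≤ m≤n = ℚ.*≤* (ℤ.*-monoʳ-≤-nonNeg (+ 1) (ℤ.+≤+ m≤n))

p*ι↧p : ∀ p → 0ℚ ℚ.≤ p → p ℚ.* ι (↧ₙ p) ≡ ι ℤ.∣ ↥ p ∣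
p*ι↧p (mkℚ -[1+ n ] d _)  (ℚ.*≤* ())
p*ι↧p p@(mkℚ (+ n) d _) _ = ℚ.toℚᵘ-injective (ℚᵘ.≃-trans (ℚ.toℚᵘ-homo-* p (ι (suc d)))
  (ℚᵘ.*≡* (trans (ℤ.*-identityʳ _)
    (cong (λ k → + n ℤ.* + k) (sym (ℕ.*-identityʳ (suc d)))))))

i/n*ιn : ∀ i n → (i ℚ./ suc n) ℚ.* ι (suc n) ≡ i ℚ./ 1
i/n*ιn i n = ℚ.toℚᵘ-injective
  (ℚᵘ.≃-trans (ℚ.toℚᵘ-homo-* (i ℚ./ suc n) (ι (suc n)))
  (ℚᵘ.≃-trans (ℚᵘ.*-congʳ (ℚ.toℚᵘ-fromℚᵘ (ℚᵘ.mkℚᵘ i n)))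
  (ℚᵘ.≃-trans (ℚᵘ.*≡* (trans (ℤ.*-identityʳ _)
    (cong (λ k → i ℤ.* + k) (sym (ℕ.*-identityʳ (suc n))))))
  (ℚᵘ.≃-sym (ℚ.toℚᵘ-fromℚᵘ (ℚᵘ.mkℚᵘ i 0))))))

⊖/1 : ∀ m n → (m ℤ.⊖ n) ℚ./ 1 ≡ ι m ℚ.- ι n
⊖/1 m zero = trans (ℚ.↥p/↧p≡p (ι m)) (sym (ℚ.+-identityʳ (ι m)))
⊖/1 m (suc n) = cong (ℚ._/ 1) (trans (sym (ℤ.m-n≡m⊖n m (suc n)))
  (sym (cong₂ ℤ._+_ (ℤ.*-identityʳ (+ m)) (ℤ.*-identityʳ -[1+ n ]))))

archimedean : ∀ q → ∃[ n ] q ℚ.< ι n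
archimedean q@(mkℚ i d _) = suc ℤ.∣ i ∣ , ℚ.*<* (begin-strict
  i ℤ.* + 1                       ≡⟨ ℤ.*-identityʳ i ⟩
  i                               ≤⟨ i≤∣i∣ i ⟩
  + ℤ.∣ i ∣                       <⟨ ℤ.+<+ (ℕ.m≤m*n (suc ℤ.∣ i ∣) (suc d)) ⟩
  + (suc ℤ.∣ i ∣ ℕ.* suc d)       ≡⟨ ℤ.pos-* (suc ℤ.∣ i ∣) (suc d) ⟩
  + suc ℤ.∣ i ∣ ℤ.* + suc d       ∎)
  where open ℤ.≤-Reasoning

0≤p*p : ∀ p → 0ℚ ℚ.≤ p ℚ.* p
0≤p*p p with ℚ.≤-total 0ℚ p
... | inj₁ 0≤p = 0≤p*q 0≤p 0≤p
... | inj₂ p≤0 = ℚ.nonNegative⁻¹ (p ℚ.* p)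
  {{ℚ.nonPos*nonPos⇒nonPos p {{ℚ.nonPositive p≤0}} p {{ℚ.nonPositive p≤0}}}}

0<p*q : 0ℚ ℚ.< p → 0ℚ ℚ.< q → 0ℚ ℚ.< p ℚ.* q
0<p*q {p} {q} 0<p 0<q = ℚ.positive⁻¹ (p ℚ.* q)
  {{ℚ.pos*pos⇒pos p {{ℚ.positive 0<p}} q {{ℚ.positive 0<q}}}}

0<p^n : 0ℚ ℚ.< p → ∀ n → 0ℚ ℚ.< p ^ℚ n
0<p^n 0<p zero    = ℚ.positive⁻¹ 1ℚ
0<p^n 0<p (suc n) = 0<p*q 0<p (0<p^n 0<p n)

^-monoˡ-≤ : 0ℚ ℚ.≤ p → p ℚ.≤ q → ∀ n → p ^ℚ n ℚ.≤ q ^ℚ n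
^-monoˡ-≤ 0≤p p≤q zero    = ℚ.≤-refl
^-monoˡ-≤ 0≤p p≤q (suc n) =
  *-mono-≤-nn 0≤p (0≤p^n (ℚ.≤-trans 0≤p p≤q) n) p≤q (^-monoˡ-≤ 0≤p p≤q n)

^-cancelˡ-< : 0ℚ ℚ.≤ q → ∀ n → p ^ℚ n ℚ.< q ^ℚ n → p ℚ.< q
^-cancelˡ-< {q} {p} 0≤q n pⁿ<qⁿ = ℚ.≰⇒> λ q≤p →
  ℚ.<-irrefl refl (ℚ.<-≤-trans pⁿ<qⁿ (^-monoˡ-≤ 0≤q q≤p n))

^-cancelˡ-≤ : 0ℚ ℚ.≤ q → ∀ n → p ^ℚ suc n ℚ.≤ q ^ℚ suc n → p ℚ.≤ q
^-cancelˡ-≤ 0≤q n pⁿ≤qⁿ = ℚ.≮⇒≥ λ q<p →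
  ℚ.<-irrefl refl (ℚ.<-≤-trans (^-mono-< 0≤q q<p n) pⁿ≤qⁿ)

^≤1 : 0ℚ ℚ.≤ p → p ℚ.≤ 1ℚ → ∀ n → p ^ℚ n ℚ.≤ 1ℚ
^≤1 0≤p p≤1 zero    = ℚ.≤-refl
^≤1 0≤p p≤1 (suc n) =
  *-mono-≤-nn 0≤p (ℚ.nonNegative⁻¹ 1ℚ) p≤1 (^≤1 0≤p p≤1 n)

^-antitone : 0ℚ ℚ.≤ p → p ℚ.≤ 1ℚ → ∀ {m n} → m ℕ.≤ n → p ^ℚ n ℚ.≤ p ^ℚ m
^-antitone 0≤p p≤1 {n = n} z≤n = ^≤1 0≤p p≤1 n
^-antitone {p} 0≤p p≤1 (s≤s m≤n) =
  ℚ.*-monoˡ-≤-nonNeg p {{ℚ.nonNegative 0≤p}} (^-antitone 0≤p p≤1 m≤n)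

0≤½ : 0ℚ ℚ.≤ ½
0≤½ = ℚ.nonNegative⁻¹ ½

½≤1 : ½ ℚ.≤ 1ℚ
½≤1 = ℚ.≤ᵇ⇒≤ {½} {1ℚ} _

½^-antitone : ∀ {m n} → m ℕ.≤ n → ½ ^ℚ n ℚ.≤ ½ ^ℚ m
½^-antitone = ^-antitone 0≤½ ½≤1

1^n : ∀ n → 1ℚ ^ℚ n ≡ 1ℚ
1^n zero    = refl
1^n (suc n) = trans (ℚ.*-identityˡ (1ℚ ^ℚ n)) (1^n n)

bernoulli : ∀ u → 0ℚ ℚ.≤ 1ℚ ℚ.+ u → ∀ n → 1ℚ ℚ.+ ι n ℚ.* u ℚ.≤ (1ℚ ℚ.+ u) ^ℚ n
bernoulli u 0≤1+u zero =
  ℚ.≤-reflexive (trans (cong (1ℚ ℚ.+_) (ℚ.*-zeroˡ u)) (ℚ.+-identityʳ 1ℚ))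
bernoulli u 0≤1+u (suc n) = begin
  1ℚ ℚ.+ ι (suc n) ℚ.* u
    ≡⟨ cong (λ x → 1ℚ ℚ.+ x ℚ.* u) (ι-+ 1 n) ⟩
  1ℚ ℚ.+ (1ℚ ℚ.+ ι n) ℚ.* u
    ≡⟨ ℚ.+-identityʳ _ ⟨
  1ℚ ℚ.+ (1ℚ ℚ.+ ι n) ℚ.* u ℚ.+ 0ℚ
    ≤⟨ ℚ.+-monoʳ-≤ (1ℚ ℚ.+ (1ℚ ℚ.+ ι n) ℚ.* u) (0≤p*q (0≤ι n) (0≤p*p u)) ⟩
  1ℚ ℚ.+ (1ℚ ℚ.+ ι n) ℚ.* u ℚ.+ ι n ℚ.* (u ℚ.* u)
    ≡⟨ solve 2 (λ u n → con 1ℚ :+ (con 1ℚ :+ n) :* u :+ n :* (u :* u)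
                     := (con 1ℚ :+ u) :* (con 1ℚ :+ n :* u)) refl u (ι n) ⟩
  (1ℚ ℚ.+ u) ℚ.* (1ℚ ℚ.+ ι n ℚ.* u)
    ≤⟨ ℚ.*-monoˡ-≤-nonNeg (1ℚ ℚ.+ u) {{ℚ.nonNegative 0≤1+u}} (bernoulli u 0≤1+u n) ⟩
  (1ℚ ℚ.+ u) ^ℚ suc n ∎
  where
  open ℚ.≤-Reasoning
  open +-*-Solver

-- For u = ρ - 1 with denominator d, the product u d is a positive integer, so Bernoulli's
-- inequality at the exponent d M gives at least 1 + M.
powers-unbounded : ∀ {ρ} → 1ℚ ℚ.< ρ → ∀ q N → ∃[ j ] (N ℕ.≤ j × q ℚ.< ρ ^ℚ j)
powers-unbounded {ρ} 1<ρ q N = d ℕ.* M , ℕ.≤-trans (ℕ.m≤m⊔n N Q) (ℕ.m≤n*m M d) , (begin-strict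
  q                          <⟨ q<Q ⟩
  ι Q                        ≤⟨ ι-mono-≤ (ℕ.m≤n⊔m N Q) ⟩
  ι M                        ≡⟨ ℚ.*-identityˡ (ι M) ⟨
  1ℚ ℚ.* ι M                 ≤⟨ ℚ.*-monoʳ-≤-nonNeg (ι M) 1≤ud ⟩
  u ℚ.* ι d ℚ.* ι M          ≡⟨ solve 3 (λ u d m → u :* d :* m := d :* m :* u) refl u (ι d) (ι M) ⟩
  ι d ℚ.* ι M ℚ.* u          ≡⟨ cong (ℚ._* u) (ι-* d M) ⟨
  ι (d ℕ.* M) ℚ.* u          ≡⟨ ℚ.+-identityˡ _ ⟨
  0ℚ ℚ.+ ι (d ℕ.* M) ℚ.* u   ≤⟨ ℚ.+-monoˡ-≤ (ι (d ℕ.* M) ℚ.* u) (0≤ι 1) ⟩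
  1ℚ ℚ.+ ι (d ℕ.* M) ℚ.* u   ≤⟨ bernoulli u 0≤1+u (d ℕ.* M) ⟩
  (1ℚ ℚ.+ u) ^ℚ (d ℕ.* M)    ≡⟨ cong (_^ℚ (d ℕ.* M)) 1+u≡ρ ⟩
  ρ ^ℚ (d ℕ.* M)             ∎)
  where
  open ℚ.≤-Reasoning
  open +-*-Solver
  u = ρ ℚ.- 1ℚ
  d = ↧ₙ u
  Q = proj₁ (archimedean q)
  q<Q = proj₂ (archimedean q)
  M = N ℕ.⊔ Q
  1+u≡ρ : 1ℚ ℚ.+ u ≡ ρ
  1+u≡ρ = solve 1 (λ r → con 1ℚ :+ (r :- con 1ℚ) := r) refl ρ
  0≤1+u : 0ℚ ℚ.≤ 1ℚ ℚ.+ u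
  0≤1+u = subst (0ℚ ℚ.≤_) (sym 1+u≡ρ) (ℚ.≤-trans (0≤ι 1) (ℚ.<⇒≤ 1<ρ))
  0<u : 0ℚ ℚ.< u
  0<u = subst (ℚ._< u) (ℚ.+-inverseʳ 1ℚ) (ℚ.+-monoˡ-< (ℚ.- 1ℚ) 1<ρ)
  1≤∣↥_∣ : ∀ p → 0ℚ ℚ.< p → 1 ℕ.≤ ℤ.∣ ↥ p ∣
  1≤∣↥ mkℚ (+ suc n) _ _ ∣ _           = s≤s z≤n
  1≤∣↥ mkℚ (+ zero)  _ _ ∣ (ℚ.*<* (ℤ.+<+ ()))
  1≤∣↥ mkℚ -[1+ n ]  _ _ ∣ (ℚ.*<* ())
  1≤ud : 1ℚ ℚ.≤ u ℚ.* ι d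
  1≤ud = subst (1ℚ ℚ.≤_) (sym (p*ι↧p u (ℚ.<⇒≤ 0<u))) (ι-mono-≤ (1≤∣↥ u ∣ 0<u))

-- Descending from n, the first value that is at least b is followed by one below b. Monotonicity
-- plays no part in this discrete intermediate value argument.
crossing : ∀ (f : ℕ → ℚ) b n → b ℚ.≤ f 0 → f n ℚ.< b → ∃[ j ] (b ℚ.≤ f j × f (suc j) ℚ.< b)
crossing f b zero    b≤f₀ f₀<b = contradiction (ℚ.<-≤-trans f₀<b b≤f₀) (ℚ.<-irrefl refl)
crossing f b (suc n) b≤f₀ fₙ<b with f n ℚ.<? b
... | yes f<b = crossing f b n b≤f₀ f<b
... | no  f≮b = n , ℚ.≮⇒≥ f≮b , fₙ<b

-- Van der Corput's sequence

-- With θ(n) the binary expansion of n reflected at the binary point (van der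
-- Corput's sequence), belowVdC k p n decides θ(n) < p / 2 ^ k.
belowVdC : ℕ → ℕ → ℕ → Bool
belowVdC zero    zero    n = false
belowVdC zero    (suc _) n = true
belowVdC (suc k) p       n =
  if odd n then belowVdC k (p ℕ.∸ 2 ℕ.^ k) (half n) else belowVdC k p (half n)

count : (ℕ → Bool) → ℕ → ℕ
count χ zero    = 0
count χ (suc n) = toℕ (χ n) ℕ.+ count χ n

count-+ : ∀ χ m n → count χ (m ℕ.+ n) ≡ count (λ i → χ (m ℕ.+ i)) n ℕ.+ count χ m
count-+ χ m zero = cong (count χ) (ℕ.+-identityʳ m)
count-+ χ m (suc n) rewrite ℕ.+-suc m n =
  trans (cong (toℕ (χ (m ℕ.+ n)) ℕ.+_) (count-+ χ m n)) (sym (ℕ.+-assoc (toℕ (χ (m ℕ.+ n))) _ _))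

count-mono : ∀ χ {m n} → m ℕ.≤ n → count χ m ℕ.≤ count χ n
count-mono χ {m} m≤n with ℕ.m≤n⇒∃[o]m+o≡n m≤n
... | _ , refl = subst (count χ m ℕ.≤_) (sym (count-+ χ m _)) (ℕ.m≤n+m _ _)

count-⊆ : ∀ {χ ψ} → (∀ n → T (χ n) → T (ψ n)) → ∀ n → count χ n ℕ.≤ count ψ n
count-⊆ χ⊆ψ zero = z≤n
count-⊆ {χ} {ψ} χ⊆ψ (suc n) = ℕ.+-mono-≤ (toℕ-mono (χ n) (ψ n) (χ⊆ψ n)) (count-⊆ χ⊆ψ n)
  where
  toℕ-mono : ∀ a b → (T a → T b) → toℕ a ℕ.≤ toℕ b
  toℕ-mono false _     _   = z≤n
  toℕ-mono true  true  _   = s≤s z≤n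
  toℕ-mono true  false imp with () ← imp tt

count-cong : ∀ {χ ψ} → χ ≗ ψ → count χ ≗ count ψ
count-cong χ≗ψ zero    = refl
count-cong χ≗ψ (suc n) = cong₂ ℕ._+_ (cong toℕ (χ≗ψ n)) (count-cong χ≗ψ n)

count-parity : ∀ χ n →
  count χ (2 ℕ.* n) ≡ count (λ i → χ (2 ℕ.* i)) n ℕ.+ count (λ i → χ (1 ℕ.+ 2 ℕ.* i)) n
count-parity χ zero = refl
count-parity χ (suc n) = begin
  count χ (2 ℕ.* suc n)             ≡⟨ cong (count χ) (ℕ.*-suc 2 n) ⟩
  b ℕ.+ (a ℕ.+ count χ (2 ℕ.* n))   ≡⟨ cong (λ z → b ℕ.+ (a ℕ.+ z)) (count-parity χ n) ⟩
  b ℕ.+ (a ℕ.+ (x ℕ.+ y))           ≡⟨ ℕ.+-comm b _ ⟩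
  a ℕ.+ (x ℕ.+ y) ℕ.+ b             ≡⟨ cong (ℕ._+ b) (ℕ.+-assoc a x y) ⟨
  a ℕ.+ x ℕ.+ y ℕ.+ b               ≡⟨ ℕ.+-assoc (a ℕ.+ x) y b ⟩
  a ℕ.+ x ℕ.+ (y ℕ.+ b)             ≡⟨ cong (a ℕ.+ x ℕ.+_) (ℕ.+-comm y b) ⟩
  a ℕ.+ x ℕ.+ (b ℕ.+ y)             ∎
  where
  open ≡-Reasoning
  a = toℕ (χ (2 ℕ.* n))
  b = toℕ (χ (1 ℕ.+ 2 ℕ.* n))
  x = count (λ i → χ (2 ℕ.* i)) n
  y = count (λ i → χ (1 ℕ.+ 2 ℕ.* i)) n

belowVdC-even : ∀ k p n → belowVdC (suc k) p (2 ℕ.* n) ≡ belowVdC k p n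
belowVdC-even k p n rewrite odd-2* n | half-2* n = refl

belowVdC-odd : ∀ k p n →
  belowVdC (suc k) p (1 ℕ.+ 2 ℕ.* n) ≡ belowVdC k (p ℕ.∸ 2 ℕ.^ k) n
belowVdC-odd k p n rewrite odd-2* n | half-2* n = refl

-- Pour p units into two boxes of size m: the first takes p ⊓ m, and the overflow p ∸ m goes to the
-- second.
⊓-double : ∀ p m → p ℕ.⊓ m ℕ.+ (p ℕ.∸ m) ℕ.⊓ m ≡ p ℕ.⊓ (2 ℕ.* m)
⊓-double p m with ℕ.≤-total p m
... | inj₁ p≤m rewrite ℕ.m≤n⇒m⊓n≡m p≤m | ℕ.m≤n⇒m∸n≡0 p≤m | ℕ.m≤n⇒m⊓n≡m (ℕ.≤-trans p≤m (ℕ.m≤m+n m (m ℕ.+ 0))) =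
  ℕ.+-identityʳ p
... | inj₂ m≤p rewrite ℕ.m≥n⇒m⊓n≡n m≤p = trans (ℕ.+-distribˡ-⊓ m (p ℕ.∸ m) m)
  (cong₂ ℕ._⊓_ (ℕ.m+[n∸m]≡n m≤p) (cong (m ℕ.+_) (sym (ℕ.+-identityʳ m))))

-- The parity of n is the leading binary digit of θ(n), so even positions keep the threshold p and
-- odd ones get p ∸ 2^k. The minimum accounts for thresholds above 1.
count-belowVdC : ∀ k p j → count (belowVdC k p) (j ℕ.* 2 ℕ.^ k) ≡ j ℕ.* (p ℕ.⊓ 2 ℕ.^ k)
count-belowVdC zero p j rewrite ℕ.*-identityʳ j = go p j
  where
  go : ∀ p j → count (belowVdC zero p) j ≡ j ℕ.* (p ℕ.⊓ 1)
  go p zero = refl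
  go zero (suc j) = go zero j
  go (suc zero) (suc j) = cong suc (go 1 j)
  go (suc (suc p)) (suc j) = cong suc (go (suc (suc p)) j)
count-belowVdC (suc k) p j = begin
  count (belowVdC (suc k) p) (j ℕ.* (2 ℕ.* 2 ℕ.^ k))
    ≡⟨ cong (count (belowVdC (suc k) p)) (trans (sym (ℕ.*-assoc j 2 (2 ℕ.^ k)))
         (trans (cong (ℕ._* 2 ℕ.^ k) (ℕ.*-comm j 2)) (ℕ.*-assoc 2 j (2 ℕ.^ k)))) ⟩
  count (belowVdC (suc k) p) (2 ℕ.* N)
    ≡⟨ count-parity (belowVdC (suc k) p) N ⟩
  count (λ i → belowVdC (suc k) p (2 ℕ.* i)) N ℕ.+
  count (λ i → belowVdC (suc k) p (1 ℕ.+ 2 ℕ.* i)) N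
    ≡⟨ cong₂ ℕ._+_ (count-cong (belowVdC-even k p) N) (count-cong (belowVdC-odd k p) N) ⟩
  count (belowVdC k p) N ℕ.+ count (belowVdC k (p ℕ.∸ 2 ℕ.^ k)) N
    ≡⟨ cong₂ ℕ._+_ (count-belowVdC k p j) (count-belowVdC k (p ℕ.∸ 2 ℕ.^ k) j) ⟩
  j ℕ.* (p ℕ.⊓ 2 ℕ.^ k) ℕ.+ j ℕ.* ((p ℕ.∸ 2 ℕ.^ k) ℕ.⊓ 2 ℕ.^ k)
    ≡⟨ ℕ.*-distribˡ-+ j _ _ ⟨
  j ℕ.* (p ℕ.⊓ 2 ℕ.^ k ℕ.+ (p ℕ.∸ 2 ℕ.^ k) ℕ.⊓ 2 ℕ.^ k)
    ≡⟨ cong (j ℕ.*_) (⊓-double p (2 ℕ.^ k)) ⟩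
  j ℕ.* (p ℕ.⊓ (2 ℕ.* 2 ℕ.^ k)) ∎
  where
  open ≡-Reasoning
  N = j ℕ.* 2 ℕ.^ k

belowVdC⇒0< : ∀ k p n → T (belowVdC k p n) → 0 ℕ.< p
belowVdC⇒0< zero (suc p) n _ = s≤s z≤n
belowVdC⇒0< (suc k) p n h with odd n
... | true  = ℕ.≤-trans (belowVdC⇒0< k (p ℕ.∸ 2 ℕ.^ k) (half n) h) (ℕ.m∸n≤m p (2 ℕ.^ k))
... | false = belowVdC⇒0< k p (half n) h

belowVdC-full : ∀ k p n → 2 ℕ.^ k ℕ.≤ p → T (belowVdC k p n)
belowVdC-full zero (suc p) n _ = tt
belowVdC-full (suc k) p n 2^≤p with odd n
... | true  = belowVdC-full k (p ℕ.∸ 2 ℕ.^ k) (half n) (ℕ.m+n≤o⇒m≤o∸n (2 ℕ.^ k)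
  (ℕ.≤-trans (ℕ.≤-reflexive (cong (2 ℕ.^ k ℕ.+_) (sym (ℕ.+-identityʳ (2 ℕ.^ k))))) 2^≤p))
... | false = belowVdC-full k p (half n) (ℕ.≤-trans (ℕ.m≤m+n (2 ℕ.^ k) _) 2^≤p)

-- This is θ(n) < p / 2^k ≤ q / 2^l. As θ has no definition of its own, the proof goes digit by
-- digit, the same leading digit being removed from both thresholds.
belowVdC-mono : ∀ k l p q n → p ℕ.* 2 ℕ.^ l ℕ.≤ q ℕ.* 2 ℕ.^ k →
  T (belowVdC k p n) → T (belowVdC l q n)
belowVdC-mono zero l (suc p) q n le h = belowVdC-full l q n
  (ℕ.≤-trans (ℕ.m≤m+n (2 ℕ.^ l) (p ℕ.* 2 ℕ.^ l)) (ℕ.≤-trans le (ℕ.≤-reflexive (ℕ.*-identityʳ q))))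
belowVdC-mono (suc k) zero p zero n le h
  with () ← ℕ.<-≤-trans (belowVdC⇒0< (suc k) p n h)
              (ℕ.≤-trans (ℕ.≤-reflexive (sym (ℕ.*-identityʳ p))) le)
belowVdC-mono (suc k) zero p (suc q) n le h = tt
belowVdC-mono (suc k) (suc l) p q n le h = go (odd n) h
  where
  P = 2 ℕ.^ k
  Q = 2 ℕ.^ l
  swap : ∀ a b → a ℕ.* (2 ℕ.* b) ≡ 2 ℕ.* (a ℕ.* b)
  swap a b = trans (sym (ℕ.*-assoc a 2 b)) (trans (cong (ℕ._* b) (ℕ.*-comm a 2)) (ℕ.*-assoc 2 a b))
  le′ : p ℕ.* Q ℕ.≤ q ℕ.* P
  le′ = ℕ.*-cancelˡ-≤ 2 (subst₂ ℕ._≤_ (swap p Q) (swap q P) le)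
  le″ : (p ℕ.∸ P) ℕ.* Q ℕ.≤ (q ℕ.∸ Q) ℕ.* P
  le″ = subst₂ ℕ._≤_ (sym (ℕ.*-distribʳ-∸ Q p P))
    (trans (cong (q ℕ.* P ℕ.∸_) (ℕ.*-comm P Q)) (sym (ℕ.*-distribʳ-∸ P q Q)))
    (ℕ.∸-monoˡ-≤ (P ℕ.* Q) le′)
  go : ∀ b → T (if b then belowVdC k (p ℕ.∸ P) (half n) else belowVdC k p (half n)) →
    T (if b then belowVdC l (q ℕ.∸ Q) (half n) else belowVdC l q (half n))
  go true  = belowVdC-mono k l (p ℕ.∸ P) (q ℕ.∸ Q) (half n) le″
  go false = belowVdC-mono k l p q (half n) le′

belowVdC-decidable : ∀ {m} k p {f} → Computable {m} f → Decidable λ xs → belowVdC k p (f xs)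
belowVdC-decidable zero    zero    cf = const-computable 0
belowVdC-decidable zero    (suc p) cf = const-computable 1
belowVdC-decidable (suc k) p {f} cf = cast
  (if-computable (odd-decidable cf)
    (belowVdC-decidable k (p ℕ.∸ 2 ℕ.^ k) (half-computable cf))
    (belowVdC-decidable k p (half-computable cf)))
  λ xs → toℕ-if (odd (f xs))
  where
  toℕ-if : ∀ b {x y} → (if b then toℕ x else toℕ y) ≡ toℕ (if b then x else y)
  toℕ-if false = refl
  toℕ-if true  = refl

-- Rational approximation of powers of 2

-- The choice is y = 1 - u with u = 1 / (2 M). Bernoulli's inequality for - u gives y^M at least 1 -
-- M u = 1/2; for u it gives (1 + u)^(2 M) at least 2, and y (1 + u) ≤ 1 transfers this to y.
near-one : ∀ M .{{_ : ℕ.NonZero M}} →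
  ∃[ y ] (0ℚ ℚ.< y × y ℚ.≤ 1ℚ × ½ ℚ.≤ y ^ℚ M × y ^ℚ (2 ℕ.* M) ℚ.≤ ½)
near-one M@(suc m) = y , 0<y , y≤1 , ½≤yᴹ , yᵂ≤½
  where
  open ℚ.≤-Reasoning
  open +-*-Solver
  W = 2 ℕ.* M
  u = ℚ.1/ ι W
  y = 1ℚ ℚ.+ ℚ.- u
  0<u : 0ℚ ℚ.< u
  0<u = ℚ.positive⁻¹ u {{ℚ.1/pos⇒pos (ι W)}}
  u*W≡1 : u ℚ.* ι W ≡ 1ℚ
  u*W≡1 = ℚ.*-inverseˡ (ι W)
  M*u≡½ : ι M ℚ.* u ≡ ½
  M*u≡½ = begin-equality
    ι M ℚ.* u
      ≡⟨ solve 2 (λ m u → m :* u := con ½ :* (u :* (con (ι 2) :* m))) refl (ι M) u ⟩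
    ½ ℚ.* (u ℚ.* (ι 2 ℚ.* ι M)) ≡⟨ cong (λ w → ½ ℚ.* (u ℚ.* w)) (ι-* 2 M) ⟨
    ½ ℚ.* (u ℚ.* ι W)           ≡⟨ cong (½ ℚ.*_) u*W≡1 ⟩
    ½                           ∎
  u≤½ : u ℚ.≤ ½
  u≤½ = begin
    u          ≡⟨ ℚ.*-identityˡ u ⟨
    1ℚ ℚ.* u   ≤⟨ ℚ.*-monoʳ-≤-nonNeg u {{ℚ.nonNegative (ℚ.<⇒≤ 0<u)}} (ι-mono-≤ {1} {M} (s≤s z≤n)) ⟩
    ι M ℚ.* u  ≡⟨ M*u≡½ ⟩
    ½          ∎
  ½≤y : ½ ℚ.≤ y
  ½≤y = ℚ.+-monoʳ-≤ 1ℚ (ℚ.neg-antimono-≤ u≤½)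
  0<y : 0ℚ ℚ.< y
  0<y = ℚ.<-≤-trans (ℚ.positive⁻¹ ½) ½≤y
  y≤1 : y ℚ.≤ 1ℚ
  y≤1 = ℚ.+-monoʳ-≤ 1ℚ (ℚ.neg-antimono-≤ (ℚ.<⇒≤ 0<u))
  ½≤yᴹ : ½ ℚ.≤ y ^ℚ M
  ½≤yᴹ = begin
    ½                          ≡⟨⟩
    1ℚ ℚ.+ ℚ.- ½               ≡⟨ cong (λ x → 1ℚ ℚ.+ ℚ.- x) M*u≡½ ⟨
    1ℚ ℚ.+ ℚ.- (ι M ℚ.* u)     ≡⟨ cong (1ℚ ℚ.+_) (ℚ.neg-distribʳ-* (ι M) u) ⟩
    1ℚ ℚ.+ ι M ℚ.* (ℚ.- u)     ≤⟨ bernoulli (ℚ.- u) (ℚ.<⇒≤ 0<y) M ⟩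
    y ^ℚ M                     ∎
  0≤1+u : 0ℚ ℚ.≤ 1ℚ ℚ.+ u
  0≤1+u = ℚ.+-mono-≤ (0≤ι 1) (ℚ.<⇒≤ 0<u)
  y[1+u]≤1 : y ℚ.* (1ℚ ℚ.+ u) ℚ.≤ 1ℚ
  y[1+u]≤1 = begin
    y ℚ.* (1ℚ ℚ.+ u)
      ≡⟨ solve 1 (λ u → (con 1ℚ :+ :- u) :* (con 1ℚ :+ u) := con 1ℚ :+ :- (u :* u)) refl u ⟩
    1ℚ ℚ.+ ℚ.- (u ℚ.* u)   ≤⟨ ℚ.+-monoʳ-≤ 1ℚ (ℚ.neg-antimono-≤ (0≤p*p u)) ⟩
    1ℚ                     ∎
  2≤[1+u]ᵂ : ι 2 ℚ.≤ (1ℚ ℚ.+ u) ^ℚ W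
  2≤[1+u]ᵂ = begin
    1ℚ ℚ.+ 1ℚ           ≡⟨ cong (1ℚ ℚ.+_) (trans (sym u*W≡1) (ℚ.*-comm u (ι W))) ⟩
    1ℚ ℚ.+ ι W ℚ.* u    ≤⟨ bernoulli u 0≤1+u W ⟩
    (1ℚ ℚ.+ u) ^ℚ W     ∎
  yᵂ≤½ : y ^ℚ W ℚ.≤ ½
  yᵂ≤½ = ℚ.*-cancelʳ-≤-pos (ι 2) (begin
    y ^ℚ W ℚ.* ι 2
      ≤⟨ ℚ.*-monoˡ-≤-nonNeg (y ^ℚ W) {{ℚ.nonNegative (0≤p^n (ℚ.<⇒≤ 0<y) W)}} 2≤[1+u]ᵂ ⟩
    y ^ℚ W ℚ.* (1ℚ ℚ.+ u) ^ℚ W      ≡⟨ ℚ^.^-distrib-* y (1ℚ ℚ.+ u) W ⟨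
    (y ℚ.* (1ℚ ℚ.+ u)) ^ℚ W         ≤⟨ ^≤1 (0≤p*q (ℚ.<⇒≤ 0<y) 0≤1+u) y[1+u]≤1 W ⟩
    1ℚ                              ≡⟨⟩
    ½ ℚ.* ι 2                       ∎)

½^-suc-< : ∀ n → ½ ^ℚ suc n ℚ.< ½ ^ℚ n
½^-suc-< n = subst (½ ^ℚ suc n ℚ.<_) (ℚ.*-identityˡ (½ ^ℚ n))
  (ℚ.*-monoˡ-<-pos (½ ^ℚ n) {{ℚ.positive (0<p^n (ℚ.positive⁻¹ ½) n)}} {½} {1ℚ}
    (ℚ.*<* (ℤ.+<+ (s≤s (s≤s z≤n)))))

-- c lies between 2 ^ (- P / L) and 2 ^ (- p / K).  It is found among the powers
-- of y, which is so close to 1 that two consecutive ones do not straddle both.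
root-among-powers : ∀ k L p P → p ℕ.* L ℕ.< P ℕ.* suc k →
  ∀ y → 0ℚ ℚ.< y → y ℚ.≤ 1ℚ → ½ ℚ.≤ y ^ℚ (suc k ℕ.* L) → y ^ℚ (2 ℕ.* (suc k ℕ.* L)) ℚ.≤ ½ →
  ∃[ c ] (0ℚ ℚ.< c × c ℚ.≤ 1ℚ × c ^ℚ suc k ℚ.< ½ ^ℚ p × ½ ^ℚ P ℚ.≤ c ^ℚ L)
root-among-powers k L p P pL<PK y 0<y y≤1 ½≤yᴹ yᵂ≤½ =
  c , 0<p^n 0<y (suc j) , ^≤1 0≤y y≤1 (suc j) , c^K<½^p , ℚ.≮⇒≥ c^L≮½^P
  where
  open ℚ.≤-Reasoning
  K = suc k
  M = K ℕ.* L
  W = 2 ℕ.* M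
  0≤y = ℚ.<⇒≤ 0<y
  f : ℕ → ℚ
  f j = (y ^ℚ j) ^ℚ K
  -- Each block of W factors y costs at least a factor ½; the extra block makes the inequality
  -- strict.
  N = W ℕ.* suc p
  f[N]<½^p : f N ℚ.< ½ ^ℚ p
  f[N]<½^p = begin-strict
    (y ^ℚ N) ^ℚ K          ≤⟨ ^-antitone (0≤p^n 0≤y N) (^≤1 0≤y y≤1 N) (s≤s (z≤n {k})) ⟩
    (y ^ℚ N) ^ℚ 1          ≡⟨ ℚ.*-identityʳ (y ^ℚ N) ⟩
    y ^ℚ N                 ≡⟨ ℚ^.^-assocʳ y W (suc p) ⟨
    (y ^ℚ W) ^ℚ suc p      ≤⟨ ^-monoˡ-≤ (0≤p^n 0≤y W) yᵂ≤½ (suc p) ⟩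
    ½ ^ℚ suc p             <⟨ ½^-suc-< p ⟩
    ½ ^ℚ p                 ∎
  cross = crossing f (½ ^ℚ p) N
    (subst (½ ^ℚ p ℚ.≤_) (sym (1^n K)) (^≤1 0≤½ ½≤1 p)) f[N]<½^p
  j = proj₁ cross
  c = y ^ℚ suc j
  c^K<½^p = proj₂ (proj₂ cross)
  c^L≮½^P : ¬ c ^ℚ L ℚ.< ½ ^ℚ P
  -- The step from y^j to c = y^(j + 1) costs at most a factor ½ at the power M. Since p L + 1 ≤ P
  -- K, that much is available.
  c^L≮½^P c^L<½^P = ℚ.<-irrefl refl (begin-strict
    ½ ^ℚ (P ℕ.* K)                       ≤⟨ ½^-antitone pL<PK ⟩
    ½ ℚ.* ½ ^ℚ (p ℕ.* L)                 ≡⟨ cong (½ ℚ.*_) (ℚ^.^-assocʳ ½ p L) ⟨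
    ½ ℚ.* (½ ^ℚ p) ^ℚ L                  ≤⟨ *-mono-≤-nn 0≤½ (0≤p^n (0≤p^n (0≤p^n 0≤y j) K) L) ½≤yᴹ
                                              (^-monoˡ-≤ (0≤p^n 0≤½ p) (proj₁ (proj₂ cross)) L) ⟩
    y ^ℚ M ℚ.* ((y ^ℚ j) ^ℚ K) ^ℚ L      ≡⟨ cong (y ^ℚ M ℚ.*_) (ℚ^.^-assocʳ (y ^ℚ j) K L) ⟩
    y ^ℚ M ℚ.* (y ^ℚ j) ^ℚ M             ≡⟨ ℚ^.^-distrib-* y (y ^ℚ j) M ⟨
    c ^ℚ M                               ≡⟨ cong (c ^ℚ_) (ℕ.*-comm K L) ⟩
    c ^ℚ (L ℕ.* K)                       ≡⟨ ℚ^.^-assocʳ c L K ⟨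
    (c ^ℚ L) ^ℚ K                        <⟨ ^-mono-< (0≤p^n (0≤p^n 0≤y (suc j)) L) c^L<½^P k ⟩
    (½ ^ℚ P) ^ℚ K                        ≡⟨ ℚ^.^-assocʳ ½ P K ⟩
    ½ ^ℚ (P ℕ.* K)                       ∎)

rational-root : ∀ K L p P .{{_ : ℕ.NonZero K}} .{{_ : ℕ.NonZero L}} → p ℕ.* L ℕ.< P ℕ.* K →
  ∃[ c ] (0ℚ ℚ.< c × c ℚ.≤ 1ℚ × c ^ℚ K ℚ.< ½ ^ℚ p × ½ ^ℚ P ℚ.≤ c ^ℚ L)
rational-root K@(suc k) L p P pL<PK =
  let y , 0<y , y≤1 , ½≤yᴹ , yᵂ≤½ = near-one (K ℕ.* L) {{ℕ.m*n≢0 K L}}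
  in root-among-powers k L p P pL<PK y 0<y y≤1 ½≤yᴹ yᵂ≤½

-- Diagonalising against countably many supergales

sum : (ℕ → ℚ) → ℕ → ℚ
sum r zero    = 0ℚ
sum r (suc N) = sum r N ℚ.+ r N

sum-+ : ∀ r s N → sum (λ i → r i ℚ.+ s i) N ≡ sum r N ℚ.+ sum s N
sum-+ r s zero    = refl
sum-+ r s (suc N) = trans (cong (ℚ._+ (r N ℚ.+ s N)) (sum-+ r s N))
  (solve 4 (λ a b x y → a :+ b :+ (x :+ y) := a :+ x :+ (b :+ y)) refl
    (sum r N) (sum s N) (r N) (s N))
  where open +-*-Solver

sum-mono-≤ : ∀ {r s} → (∀ i → r i ℚ.≤ s i) → ∀ N → sum r N ℚ.≤ sum s N
sum-mono-≤ r≤s zero    = ℚ.≤-refl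
sum-mono-≤ r≤s (suc N) = ℚ.+-mono-≤ (sum-mono-≤ r≤s N) (r≤s N)

sum-monoʳ-≤ : ∀ {r} → (∀ i → 0ℚ ℚ.≤ r i) → ∀ {M N} → M ℕ.≤ N → sum r M ℚ.≤ sum r N
sum-monoʳ-≤ {r} 0≤r {M} M≤N = go (ℕ.≤⇒≤′ M≤N)
  where
  go : ∀ {N} → M ℕ.≤′ N → sum r M ℚ.≤ sum r N
  go ℕ.≤′-refl               = ℚ.≤-refl
  go (ℕ.≤′-step {n = N} M≤N) = ℚ.≤-trans (go M≤N)
    (subst (ℚ._≤ sum r N ℚ.+ r N) (ℚ.+-identityʳ (sum r N)) (ℚ.+-monoʳ-≤ (sum r N) (0≤r N)))

term≤sum : ∀ {r} → (∀ i → 0ℚ ℚ.≤ r i) → ∀ i → r i ℚ.≤ sum r (suc i)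
term≤sum {r} 0≤r i = subst (ℚ._≤ sum r i ℚ.+ r i) (ℚ.+-identityˡ (r i))
  (ℚ.+-monoˡ-≤ (r i) (sum-monoʳ-≤ 0≤r {0} {i} z≤n))

sum-½^ : ∀ N → sum (λ i → ½ ^ℚ suc i) N ℚ.+ ½ ^ℚ N ≡ 1ℚ
sum-½^ zero    = refl
sum-½^ (suc N) = trans
  (solve 2 (λ s h → s :+ con ½ :* h :+ con ½ :* h := s :+ h) refl
    (sum (λ i → ½ ^ℚ suc i) N) (½ ^ℚ N))
  (sum-½^ N)
  where open +-*-Solver

sum-½^≤1 : ∀ N → sum (λ i → ½ ^ℚ suc i) N ℚ.≤ 1ℚ
sum-½^≤1 N = subst₂ ℚ._≤_ (ℚ.+-identityʳ _) (sum-½^ N)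
  (ℚ.+-monoʳ-≤ (sum (λ i → ½ ^ℚ suc i) N) (0≤p^n 0≤½ N))

-- Lower sets E i w of supergales w ↦ sup (E i w), with a rational factor c i in
-- place of 2 ^ (- s).
record Supergales : Set₁ where
  field
    E           : ℕ → String → ℚ → Set
    c           : ℕ → ℚ
    B           : ℕ → ℕ
    0≤c         : ∀ i → 0ℚ ℚ.≤ c i
    E-nonpos    : ∀ {i w q} → q ℚ.≤ 0ℚ → E i w q
    E-supergale : ∀ {i w q r} → E i (w ∷ʳ false) q → E i (w ∷ʳ true) r →
                  E i w (c i ℚ.* (q ℚ.+ r))
    E-initial   : ∀ {i q} → E i [] q → q ℚ.≤ ι (suc (B i))

module Diagonal (em : ∀ (P : Set) → Dec P) (𝓔 : Supergales) (A : ℕ → Bool) where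
  open Supergales 𝓔

  -- The second factor normalises the initial value of the i-th supergale to at most 1; the first
  -- makes the weighted sum at the empty string at most 1.
  ε : ℕ → ℚ
  ε i = ½ ^ℚ suc i ℚ.* ℚ.1/ ι (suc (B i))

  0<1/B : ∀ i → 0ℚ ℚ.< ℚ.1/ ι (suc (B i))
  0<1/B i = ℚ.positive⁻¹ (ℚ.1/ ι (suc (B i))) {{ℚ.1/pos⇒pos (ι (suc (B i)))}}

  0<ε : ∀ i → 0ℚ ℚ.< ε i
  0<ε i = 0<p*q (0<p^n (ℚ.positive⁻¹ ½) (suc i)) (0<1/B i)

  -- Rationals up to ε_i c_i^n times the i-th supergale at w. Closure downwards is built in, as `E`
  -- is not assumed to have it.
  Scaled : ℕ → String → ℕ → ℚ → Set
  Scaled n w i q = ∃[ r ] (E i w r × q ℚ.≤ ε i ℚ.* c i ^ℚ n ℚ.* r)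

  Scaled-0 : ∀ n w i → Scaled n w i 0ℚ
  Scaled-0 n w i = 0ℚ , E-nonpos ℚ.≤-refl , ℚ.≤-reflexive (sym (ℚ.*-zeroʳ (ε i ℚ.* c i ^ℚ n)))

  -- The additional factor `c i` at length n + 1 is the one in `E-supergale`, so after scaling the
  -- values of the two children add up to at most that of w.
  Scaled-+ : ∀ {n w i q r} → Scaled (suc n) (w ∷ʳ false) i q →
    Scaled (suc n) (w ∷ʳ true) i r → Scaled n w i (q ℚ.+ r)
  Scaled-+ {n} {w} {i} {q} {r} (q′ , Eq′ , q≤) (r′ , Er′ , r≤) =
    c i ℚ.* (q′ ℚ.+ r′) , E-supergale Eq′ Er′ , ℚ.≤-trans (ℚ.+-mono-≤ q≤ r≤)
      (ℚ.≤-reflexive (solve 5 (λ e c x q r →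
          e :* (c :* x) :* q :+ e :* (c :* x) :* r := e :* x :* (c :* (q :+ r)))
        refl (ε i) (c i) (c i ^ℚ n) q′ r′))
    where open +-*-Solver

  -- Bounds the infinite weighted sum without forming it: every finite sum of nonnegative rationals
  -- below the terms obeys the bound.
  Good : ℕ → String → Set
  Good n w = ∀ N (r : ℕ → ℚ) → (∀ i → 0ℚ ℚ.≤ r i) → (∀ i → Scaled n w i (r i)) →
    sum r N ℚ.≤ ½ ^ℚ count A n

  good-[] : Good 0 []
  good-[] N r _ scaled = ℚ.≤-trans (sum-mono-≤ r≤½^ N) (sum-½^≤1 N)
    where
    open ℚ.≤-Reasoning
    r≤½^ : ∀ i → r i ℚ.≤ ½ ^ℚ suc i
    r≤½^ i with scaled i
    ... | q , Eq , r≤ = begin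
      r i                                   ≤⟨ r≤ ⟩
      ε i ℚ.* 1ℚ ℚ.* q
        ≤⟨ ℚ.*-monoˡ-≤-nonNeg (ε i ℚ.* 1ℚ) {{ℚ.nonNegative 0≤ε1}} (E-initial Eq) ⟩
      h ℚ.* u ℚ.* 1ℚ ℚ.* ι (suc (B i))      ≡⟨ cong (ℚ._* ι (suc (B i))) (ℚ.*-identityʳ (h ℚ.* u)) ⟩
      h ℚ.* u ℚ.* ι (suc (B i))             ≡⟨ ℚ.*-assoc h u (ι (suc (B i))) ⟩
      h ℚ.* (u ℚ.* ι (suc (B i)))           ≡⟨ cong (h ℚ.*_) (ℚ.*-inverseˡ (ι (suc (B i)))) ⟩
      h ℚ.* 1ℚ                              ≡⟨ ℚ.*-identityʳ h ⟩
      h                                     ∎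
      where
      h = ½ ^ℚ suc i
      u = ℚ.1/ ι (suc (B i))
      0≤ε1 : 0ℚ ℚ.≤ ε i ℚ.* 1ℚ
      0≤ε1 = subst (0ℚ ℚ.≤_) (sym (ℚ.*-identityʳ (ε i))) (ℚ.<⇒≤ (0<ε i))

  good-forced : ∀ {n w} → A n ≡ false → Good n w → Good (suc n) (w ∷ʳ false)
  good-forced {n} {w} An≡false good N r 0≤r scaled rewrite An≡false =
    good N r 0≤r λ i → subst (Scaled n w i) (ℚ.+-identityʳ (r i))
      (Scaled-+ {n} (scaled i) (Scaled-0 (suc n) (w ∷ʳ true) i))

  -- If both children exceeded half of x, their two violating families, summed up to a common length
  -- and added termwise, would violate `Good` at w.
  good-free : ∀ {n w} → A n ≡ true → Good n w →
    ¬ Good (suc n) (w ∷ʳ false) → Good (suc n) (w ∷ʳ true)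
  good-free {n} {w} An≡true good ¬good N r 0≤r scaled rewrite An≡true = ℚ.≮⇒≥ λ h<Σr →
    ¬good λ N′ r′ 0≤r′ scaled′ → ℚ.≮⇒≥ λ h<Σr′ → let M = N′ ℕ.⊔ N in
    ℚ.<-irrefl refl (begin-strict
      x                                      ≡⟨ halves x ⟩
      x ℚ.* ½ ℚ.+ x ℚ.* ½                    ≡⟨ cong₂ ℚ._+_ (ℚ.*-comm x ½) (ℚ.*-comm x ½) ⟩
      ½ ^ℚ suc (count A n) ℚ.+ ½ ^ℚ suc (count A n)
                                             <⟨ ℚ.+-mono-< h<Σr′ h<Σr ⟩
      sum r′ N′ ℚ.+ sum r N                  ≤⟨ ℚ.+-mono-≤ (sum-monoʳ-≤ 0≤r′ (ℕ.m≤m⊔n N′ N))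
                                                           (sum-monoʳ-≤ 0≤r (ℕ.m≤n⊔m N′ N)) ⟩
      sum r′ M ℚ.+ sum r M                   ≡⟨ sum-+ r′ r M ⟨
      sum (λ i → r′ i ℚ.+ r i) M             ≤⟨ good M _ (λ i → ℚ.+-mono-≤ (0≤r′ i) (0≤r i))
                                                  (λ i → Scaled-+ {n} (scaled′ i) (scaled i)) ⟩
      x                                      ∎)
    where
    open ℚ.≤-Reasoning
    x = ½ ^ℚ count A n

  next : ∀ n w → Good n w → ∃[ b ] (Good (suc n) (w ∷ʳ b) × (T b → T (A n)))
  next n w good = go (A n) refl (em (Good (suc n) (w ∷ʳ false)))
    where
    go : ∀ a → A n ≡ a → Dec (Good (suc n) (w ∷ʳ false)) →
         ∃[ b ] (Good (suc n) (w ∷ʳ b) × (T b → T (A n)))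
    go false An≡ _           = false , good-forced {n} {w} An≡ good , λ ()
    go true  An≡ (yes good₀) = false , good₀ , λ ()
    go true  An≡ (no ¬good₀) =
      true , good-free {n} {w} An≡ good ¬good₀ , λ _ → subst T (sym An≡) tt

  state : ∀ n → ∃[ w ] Good n w
  state zero    = [] , good-[]
  state (suc n) = let b , good , _ = next n _ (proj₂ (state n)) in proj₁ (state n) ∷ʳ b , good

  S : Cantor
  S n = proj₁ (next n _ (proj₂ (state n)))

  S⊆A : ∀ n → T (S n) → T (A n)
  S⊆A n = proj₂ (proj₂ (next n _ (proj₂ (state n))))

  state≡prefix : ∀ n → proj₁ (state n) ≡ prefix S n
  state≡prefix zero    = refl
  state≡prefix (suc n) = trans (cong (_∷ʳ S n) (state≡prefix n)) (List.applyUpTo-∷ʳ S n)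

  -- `Good` is applied to the family that vanishes off i. It admits only nonnegative families, hence
  -- the separate treatment of values at most 0.
  S-bound : ∀ {i n q} → E i (prefix S n) q → ε i ℚ.* c i ^ℚ n ℚ.* q ℚ.≤ ½ ^ℚ count A n
  S-bound {i} {n} {q} Eq with ℚ.≤-total 0ℚ (ε i ℚ.* c i ^ℚ n ℚ.* q)
  ... | inj₂ v≤0 = ℚ.≤-trans v≤0 (0≤p^n 0≤½ (count A n))
  ... | inj₁ 0≤v = ℚ.≤-trans v≤rᵢ (ℚ.≤-trans (term≤sum 0≤r i) (proj₂ (state n) (suc i) r 0≤r scaled))
    where
    v = ε i ℚ.* c i ^ℚ n ℚ.* q
    r : ℕ → ℚ
    r j = if j ℕ.≡ᵇ i then v else 0ℚ
    ≡ᵇ-refl : ∀ i → (i ℕ.≡ᵇ i) ≡ true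
    ≡ᵇ-refl zero    = refl
    ≡ᵇ-refl (suc i) = ≡ᵇ-refl i
    v≤rᵢ : v ℚ.≤ r i
    v≤rᵢ rewrite ≡ᵇ-refl i = ℚ.≤-refl
    0≤r : ∀ j → 0ℚ ℚ.≤ r j
    0≤r j with j ℕ.≡ᵇ i
    ... | true  = 0≤v
    ... | false = ℚ.≤-refl
    scaled : ∀ j → Scaled n (proj₁ (state n)) j (r j)
    scaled j with j ℕ.≡ᵇ i in j≡ᵇi
    ... | false = Scaled-0 n (proj₁ (state n)) j
    ... | true with ℕ.≡ᵇ⇒≡ j i (subst T (sym j≡ᵇi) tt)
    ...   | refl = q , subst (λ w → E j w q) (sym (state≡prefix n)) Eq , ℚ.≤-refl

  -- Per period of 2 ^ k positions at least p bits are free, which outweighs the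
  -- growth factor c i ^ (- 2 ^ k) of the supergale.
  S-bounded : ∀ {i} k p → p ℕ.≤ 2 ℕ.^ k → 0ℚ ℚ.< c i → c i ℚ.≤ 1ℚ →
    ½ ^ℚ p ℚ.≤ c i ^ℚ (2 ℕ.^ k) → (∀ n → T (belowVdC k p n) → T (A n)) →
    ∃[ b ] ∀ n q → E i (prefix S n) q → q ℚ.≤ b
  S-bounded {i} k p p≤K 0<c c≤1 ½^p≤c^K below⊆A = b , bounded
    where
    open ℚ.≤-Reasoning
    open +-*-Solver
    instance
      K≢0 : ℕ.NonZero (2 ℕ.^ k)
      K≢0 = ℕ.m^n≢0 2 k
    K = 2 ℕ.^ k
    x = c i
    0≤x = ℚ.<⇒≤ 0<c
    -- One full period `x ^ℚ K` pays for the incomplete one of length n % K, as x ≤ 1; this makes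
    -- the bound 1 / g independent of n.
    g = ε i ℚ.* x ^ℚ K
    0<g : 0ℚ ℚ.< g
    0<g = 0<p*q (0<ε i) (0<p^n 0<c K)
    instance
      g≢0 : ℚ.NonZero g
      g≢0 = ℚ.pos⇒nonZero g {{ℚ.positive 0<g}}
    b = ℚ.1/ g
    gb≡1 : b ℚ.* g ≡ 1ℚ
    gb≡1 = ℚ.*-inverseˡ g
    bounded : ∀ n q → E i (prefix S n) q → q ℚ.≤ b
    bounded n q Eq with ℚ.≤-total q 0ℚ
    ... | inj₁ q≤0 = ℚ.≤-trans q≤0 (ℚ.<⇒≤ (ℚ.positive⁻¹ b {{ℚ.1/pos⇒pos g {{ℚ.positive 0<g}}}}))
    ... | inj₂ 0≤q = ℚ.*-cancelʳ-≤-pos g {{ℚ.positive 0<g}} (begin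
      q ℚ.* g    ≤⟨ ℚ.*-cancelʳ-≤-pos h {{ℚ.positive 0<h}} q*g*h≤h ⟩
      1ℚ         ≡⟨ gb≡1 ⟨
      b ℚ.* g    ∎)
      where
      j = n ℕ./ K
      ρ = n ℕ.% K
      n≡ = ℕ.m≡m%n+[m/n]*n n K
      h = ½ ^ℚ (j ℕ.* p)
      0<h : 0ℚ ℚ.< h
      0<h = 0<p^n (ℚ.positive⁻¹ ½) (j ℕ.* p)
      jp≤count : j ℕ.* p ℕ.≤ count A n
      jp≤count = ℕ.≤-trans
        (ℕ.≤-reflexive (trans (cong (j ℕ.*_) (sym (ℕ.m≤n⇒m⊓n≡m p≤K))) (sym (count-belowVdC k p j))))
        (ℕ.≤-trans (count-⊆ below⊆A (j ℕ.* K)) (count-mono A (ℕ.m/n*n≤m n K)))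
      h≤x^jK : h ℚ.≤ x ^ℚ (j ℕ.* K)
      h≤x^jK = begin
        ½ ^ℚ (j ℕ.* p)     ≡⟨ cong (½ ^ℚ_) (ℕ.*-comm j p) ⟩
        ½ ^ℚ (p ℕ.* j)     ≡⟨ ℚ^.^-assocʳ ½ p j ⟨
        (½ ^ℚ p) ^ℚ j      ≤⟨ ^-monoˡ-≤ (0≤p^n 0≤½ p) ½^p≤c^K j ⟩
        (x ^ℚ K) ^ℚ j      ≡⟨ ℚ^.^-assocʳ x K j ⟩
        x ^ℚ (K ℕ.* j)     ≡⟨ cong (x ^ℚ_) (ℕ.*-comm K j) ⟩
        x ^ℚ (j ℕ.* K)     ∎
      x^Kh≤x^n : x ^ℚ K ℚ.* h ℚ.≤ x ^ℚ n
      x^Kh≤x^n = begin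
        x ^ℚ K ℚ.* h                  ≤⟨ *-mono-≤-nn (0≤p^n 0≤x K) (0≤p^n 0≤x (j ℕ.* K))
                                            (^-antitone 0≤x c≤1 (ℕ.<⇒≤ (ℕ.m%n<n n K))) h≤x^jK ⟩
        x ^ℚ ρ ℚ.* x ^ℚ (j ℕ.* K)     ≡⟨ ℚ^.^-homo-* x ρ (j ℕ.* K) ⟨
        x ^ℚ (ρ ℕ.+ j ℕ.* K)          ≡⟨ cong (x ^ℚ_) n≡ ⟨
        x ^ℚ n                        ∎
      0≤εq : 0ℚ ℚ.≤ ε i ℚ.* q
      0≤εq = 0≤p*q (ℚ.<⇒≤ (0<ε i)) 0≤q
      q*g*h≤h : q ℚ.* g ℚ.* h ℚ.≤ 1ℚ ℚ.* h
      q*g*h≤h = begin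
        q ℚ.* (ε i ℚ.* x ^ℚ K) ℚ.* h
          ≡⟨ solve 4 (λ q e y h → q :* (e :* y) :* h := e :* q :* (y :* h)) refl q (ε i) (x ^ℚ K) h ⟩
        ε i ℚ.* q ℚ.* (x ^ℚ K ℚ.* h)
          ≤⟨ ℚ.*-monoˡ-≤-nonNeg (ε i ℚ.* q) {{ℚ.nonNegative 0≤εq}} x^Kh≤x^n ⟩
        ε i ℚ.* q ℚ.* x ^ℚ n
          ≡⟨ solve 3 (λ e q y → e :* q :* y := e :* y :* q) refl (ε i) q (x ^ℚ n) ⟩
        ε i ℚ.* x ^ℚ n ℚ.* q            ≤⟨ S-bound {i} {n} Eq ⟩
        ½ ^ℚ count A n                  ≤⟨ ½^-antitone jp≤count ⟩
        h                               ≡⟨ ℚ.*-identityˡ h ⟨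
        1ℚ ℚ.* h                        ∎

-- Betting supergales

productℚ : (ℕ → Bool → ℚ) → String → ℚ
productℚ g []      = 1ℚ
productℚ g (b ∷ w) = g 0 b ℚ.* productℚ (g ∘ suc) w

productℚ-∷ʳ : ∀ g w b → productℚ g (w ∷ʳ b) ≡ productℚ g w ℚ.* g (length w) b
productℚ-∷ʳ g []      b = ℚ.*-comm (g 0 b) 1ℚ
productℚ-∷ʳ g (a ∷ w) b = trans (cong (g 0 a ℚ.*_) (productℚ-∷ʳ (g ∘ suc) w b))
  (sym (ℚ.*-assoc (g 0 a) (productℚ (g ∘ suc) w) (g (suc (length w)) b)))

0≤productℚ : ∀ {g} → (∀ n b → 0ℚ ℚ.≤ g n b) → ∀ w → 0ℚ ℚ.≤ productℚ g w
0≤productℚ 0≤g []      = 0≤ι 1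
0≤productℚ 0≤g (b ∷ w) = 0≤p*q (0≤g 0 b) (0≤productℚ (0≤g ∘ suc) w)

-- Numerators and denominators are multiplied without cancelling, so that both are products of
-- naturals to which `codeProduct` applies.
productℚ-fraction : ∀ {g num den} → (∀ n b → g n b ℚ.* ι (den n b) ≡ ι (num n b)) →
  ∀ w → productℚ g w ℚ.* ι (product den w) ≡ ι (product num w)
productℚ-fraction g≡ [] = refl
productℚ-fraction {g} {num} {den} g≡ (b ∷ w) = begin
  x ℚ.* P ℚ.* ι (den 0 b ℕ.* product (den ∘ suc) w)
    ≡⟨ cong (x ℚ.* P ℚ.*_) (ι-* (den 0 b) (product (den ∘ suc) w)) ⟩
  x ℚ.* P ℚ.* (ι (den 0 b) ℚ.* ι (product (den ∘ suc) w))
    ≡⟨ solve 4 (λ x p d q → x :* p :* (d :* q) := x :* d :* (p :* q)) refl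
         x P (ι (den 0 b)) (ι (product (den ∘ suc) w)) ⟩
  x ℚ.* ι (den 0 b) ℚ.* (P ℚ.* ι (product (den ∘ suc) w))
    ≡⟨ cong₂ ℚ._*_ (g≡ 0 b) (productℚ-fraction (g≡ ∘ suc) w) ⟩
  ι (num 0 b) ℚ.* ι (product (num ∘ suc) w)
    ≡⟨ ι-* (num 0 b) (product (num ∘ suc) w) ⟨
  ι (product num (b ∷ w)) ∎
  where
  open ≡-Reasoning
  open +-*-Solver
  x = g 0 b
  P = productℚ (g ∘ suc) w

product-nonZero : ∀ {f} → (∀ n b → ℕ.NonZero (f n b)) → ∀ w → ℕ.NonZero (product f w)
product-nonZero f≢0 []      = _
product-nonZero f≢0 (b ∷ w) =
  ℕ.m*n≢0 _ _ {{f≢0 0 b}} {{product-nonZero (f≢0 ∘ suc) w}}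

-- Lower semicomputability of products of fractions

1/suc : ℕ → ℚ
1/suc t = ℚ.1/ ι (suc t)

0<1/suc : ∀ t → 0ℚ ℚ.< 1/suc t
0<1/suc t = ℚ.positive⁻¹ (1/suc t)

1/suc-antitone : ∀ t → 1/suc (suc t) ℚ.≤ 1/suc t
1/suc-antitone t = ℚ.*≤* (ℤ.*-monoˡ-≤-nonNeg (+ 1) (ℤ.+≤+ (ℕ.n≤1+n (suc t))))

p-q<p : ∀ {p q} → 0ℚ ℚ.< q → p ℚ.- q ℚ.< p
p-q<p {p} {q} 0<q = subst (p ℚ.- q ℚ.<_) (ℚ.+-identityʳ p) (ℚ.+-monoʳ-< p (ℚ.neg-antimono-< 0<q))

1/suc-small : ∀ ε → 0ℚ ℚ.< ε → ∃[ N ] ∀ n → N ℕ.≤ n → 1/suc n ℚ.< ε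
1/suc-small ε 0<ε = N , λ n N≤n → ℚ.*-cancelʳ-<-nonNeg (ι (suc n)) (begin-strict
  1/suc n ℚ.* ι (suc n)   ≡⟨ ℚ.*-inverseˡ (ι (suc n)) ⟩
  1ℚ                      ≡⟨ ℚ.*-inverseʳ ε ⟨
  ε ℚ.* ℚ.1/ ε            <⟨ ℚ.*-monoʳ-<-pos ε {{ℚ.positive 0<ε}}
                               (ℚ.<-≤-trans 1/ε<N (ι-mono-≤ (ℕ.m≤n⇒m≤1+n N≤n))) ⟩
  ε ℚ.* ι (suc n)         ∎)
  where
  open ℚ.≤-Reasoning
  instance
    ε≢0 : ℚ.NonZero ε
    ε≢0 = ℚ.pos⇒nonZero ε {{ℚ.positive 0<ε}}
  N = proj₁ (archimedean (ℚ.1/ ε))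
  1/ε<N = proj₂ (archimedean (ℚ.1/ ε))

module _ {num den : ℕ → Bool → ℕ} (den≢0 : ∀ n b → ℕ.NonZero (den n b))
  (num-computable : Computable {2} λ xs → num (lookup xs 0F) (not (odd (lookup xs 1F))))
  (den-computable : Computable {2} λ xs → den (lookup xs 0F) (not (odd (lookup xs 1F))))
  {v : String → ℚ} (v-fraction : ∀ w → v w ℚ.* ι (product den w) ≡ ι (product num w)) where

  private
    -- Approximations must stay strictly below the value, so v w - 1 / (t + 1) is used. Over the
    -- common denominator D (t + 1), where D is `product den w`, its numerator is `a w t` minus D;
    -- `pred` fits the format (a - b) / (c + 1).
    a b c : String → ℕ → ℕ
    a w t = product num w ℕ.* suc t
    b w t = product den w
    c w t = pred (product den w ℕ.* suc t)

    a-computable : Computableℕ a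
    a-computable = computableℕ
      (*-computable (app₁ {g = λ e → codeProduct num e e} (codeProduct-computable num num-computable) (var 0F))
        (suc-computable (var 1F)))
      λ w t → cong (ℕ._* suc t) (codeProduct≡product num w)

    den-code : Computable {2} λ xs → codeProduct den (lookup xs 0F) (lookup xs 0F)
    den-code = app₁ {g = λ e → codeProduct den e e} (codeProduct-computable den den-computable) (var 0F)

    b-computable : Computableℕ b
    b-computable = computableℕ den-code λ w t → codeProduct≡product den w

    c-computable : Computableℕ c
    c-computable = computableℕ (pred-computable (*-computable den-code (suc-computable (var 1F))))
      λ w t → cong (λ d → pred (d ℕ.* suc t)) (codeProduct≡product den w)

    v-1/suc≡ : ∀ w t → v w ℚ.- 1/suc t ≡ (a w t ℤ.⊖ b w t) ℚ./ suc (c w t)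
    v-1/suc≡ w t = ℚ.≤-antisym (cancel (ℚ.≤-reflexive eq)) (cancel (ℚ.≤-reflexive (sym eq)))
      where
      open ≡-Reasoning
      open +-*-Solver
      D = product den w
      cancel : ∀ {p q} → p ℚ.* ι (suc (c w t)) ℚ.≤ q ℚ.* ι (suc (c w t)) → p ℚ.≤ q
      cancel = ℚ.*-cancelʳ-≤-pos (ι (suc (c w t)))
      suc-c : suc (c w t) ≡ D ℕ.* suc t
      suc-c = ℕ.suc-pred (D ℕ.* suc t) {{ℕ.m*n≢0 D (suc t) {{product-nonZero den≢0 w}}}}
      eq : (v w ℚ.- 1/suc t) ℚ.* ι (suc (c w t)) ≡ (a w t ℤ.⊖ b w t) ℚ./ suc (c w t) ℚ.* ι (suc (c w t))
      eq = begin
        (v w ℚ.- 1/suc t) ℚ.* ι (suc (c w t))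
          ≡⟨ cong (λ n → (v w ℚ.- 1/suc t) ℚ.* ι n) suc-c ⟩
        (v w ℚ.- 1/suc t) ℚ.* ι (D ℕ.* suc t)
          ≡⟨ cong ((v w ℚ.- 1/suc t) ℚ.*_) (ι-* D (suc t)) ⟩
        (v w ℚ.- 1/suc t) ℚ.* (ι D ℚ.* ι (suc t))
          ≡⟨ solve 4 (λ v i d s → (v :- i) :* (d :* s) := v :* d :* s :- d :* (i :* s)) refl
               (v w) (1/suc t) (ι D) (ι (suc t)) ⟩
        v w ℚ.* ι D ℚ.* ι (suc t) ℚ.- ι D ℚ.* (1/suc t ℚ.* ι (suc t))
          ≡⟨ cong₂ (λ x y → x ℚ.* ι (suc t) ℚ.- ι D ℚ.* y) (v-fraction w) (ℚ.*-inverseˡ (ι (suc t))) ⟩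
        ι (product num w) ℚ.* ι (suc t) ℚ.- ι D ℚ.* 1ℚ
          ≡⟨ cong₂ ℚ._-_ (ι-* (product num w) (suc t)) (sym (ℚ.*-identityʳ (ι D))) ⟨
        ι (a w t) ℚ.- ι D
          ≡⟨ ⊖/1 (a w t) D ⟨
        (a w t ℤ.⊖ b w t) ℚ./ 1
          ≡⟨ i/n*ιn (a w t ℤ.⊖ b w t) (c w t) ⟨
        (a w t ℤ.⊖ b w t) ℚ./ suc (c w t) ℚ.* ι (suc (c w t)) ∎

  fraction-lowerSemicomputable : LowerSemicomputable λ w → ⟦ v w ⟧
  fraction-lowerSemicomputable =
      (λ w t → v w ℚ.- 1/suc t)
    , (a , b , c , a-computable , b-computable , c-computable , v-1/suc≡)
    , (λ w t → ℚ.+-monoʳ-≤ (v w) (ℚ.neg-antimono-≤ (1/suc-antitone t))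
             , v w ℚ.- 1/suc (suc t) , ℚ.<-irrefl refl , p-q<p (0<1/suc (suc t)))
    , λ w ε 0<ε → let N , small = 1/suc-small ε 0<ε in N , λ n N≤n →
        ( v w ℚ.- 1/suc n ℚ.- ε , ℚ.<-irrefl refl
        , ℚ.<-trans (p-q<p 0<ε) (p-q<p (0<1/suc n)))
      , v w , ℚ.<-irrefl refl
      , subst (ℚ._< v w ℚ.- 1/suc n ℚ.+ ε) (p-q+q (v w) (1/suc n))
          (ℚ.+-monoʳ-< (v w ℚ.- 1/suc n) (small n N≤n))
    where
    p-q+q : ∀ p q → p ℚ.- q ℚ.+ q ≡ p
    p-q+q = solve 2 (λ p q → p :- q :+ q := p) refl
      where open +-*-Solver

-- The supergale that bets on the bits outside χ being false, χ having p
-- elements in each period of 2 ^ k positions.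
module Betting (k p : ℕ) (c e : ℚ) (0<c : 0ℚ ℚ.< c) (0<e : 0ℚ ℚ.< e) (ce≡1 : c ℚ.* e ≡ 1ℚ) where

  χ : ℕ → Bool
  χ = belowVdC k p

  -- The factors by which the two children multiply the capital. They add up to e = 1 / c whether or
  -- not n lies in χ.
  bet : ℕ → Bool → ℚ
  bet n b = if χ n then e ℚ.* ½ else (if b then 0ℚ else e)

  num den : ℕ → Bool → ℕ
  num n b = if χ n then ℤ.∣ ↥ e ∣ else (if b then 0 else ℤ.∣ ↥ e ∣)
  den n b = if χ n then 2 ℕ.* ↧ₙ e else ↧ₙ e

  den≢0 : ∀ n b → ℕ.NonZero (den n b)
  den≢0 n b with χ n
  ... | true  = _
  ... | false = _

  e*den≡num : e ℚ.* ι (↧ₙ e) ≡ ι ℤ.∣ ↥ e ∣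
  e*den≡num = p*ι↧p e (ℚ.<⇒≤ 0<e)

  bet-fraction : ∀ n b → bet n b ℚ.* ι (den n b) ≡ ι (num n b)
  bet-fraction n b with χ n | b
  ... | false | true  = ℚ.*-zeroˡ (ι (↧ₙ e))
  ... | false | false = e*den≡num
  ... | true  | _     = trans (cong (e ℚ.* ½ ℚ.*_) (ι-* 2 (↧ₙ e)))
    (trans (solve 2 (λ e f → e :* con ½ :* (con (ι 2) :* f) := e :* f) refl e (ι (↧ₙ e))) e*den≡num)
    where open +-*-Solver

  0≤bet : ∀ n b → 0ℚ ℚ.≤ bet n b
  0≤bet n b with χ n | b
  ... | true  | _     = 0≤p*q (ℚ.<⇒≤ 0<e) 0≤½
  ... | false | true  = ℚ.≤-refl
  ... | false | false = ℚ.<⇒≤ 0<e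

  bet-sum : ∀ n → bet n false ℚ.+ bet n true ≡ e
  bet-sum n with χ n
  ... | true  = sym (halves e)
  ... | false = ℚ.+-identityʳ e

  v : String → ℚ
  v = productℚ bet

  d : String → ℝ≥0
  d w = mkℝ≥0 ⟦ v w ⟧ λ q q<0 → ℚ.<-≤-trans q<0 (0≤productℚ 0≤bet w)

  d-constructive : Constructive d
  d-constructive = fraction-lowerSemicomputable den≢0
    (if-computable (belowVdC-decidable k p (var 0F)) (const-computable ℤ.∣ ↥ e ∣)
      (if-computable (not-decidable (odd-decidable (var 1F))) (const-computable 0)
        (const-computable ℤ.∣ ↥ e ∣)))
    (if-computable (belowVdC-decidable k p (var 0F)) (const-computable (2 ℕ.* ↧ₙ e))
      (const-computable (↧ₙ e)))
    (productℚ-fraction bet-fraction)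

  v-children : ∀ w → v (w ∷ʳ false) ℚ.+ v (w ∷ʳ true) ≡ e ℚ.* v w
  v-children w = begin
    v (w ∷ʳ false) ℚ.+ v (w ∷ʳ true)
      ≡⟨ cong₂ ℚ._+_ (productℚ-∷ʳ bet w false) (productℚ-∷ʳ bet w true) ⟩
    v w ℚ.* bet (length w) false ℚ.+ v w ℚ.* bet (length w) true
      ≡⟨ ℚ.*-distribˡ-+ (v w) (bet (length w) false) (bet (length w) true) ⟨
    v w ℚ.* (bet (length w) false ℚ.+ bet (length w) true)
      ≡⟨ cong (v w ℚ.*_) (bet-sum (length w)) ⟩
    v w ℚ.* e
      ≡⟨ ℚ.*-comm (v w) e ⟩
    e ℚ.* v w ∎
    where open ≡-Reasoning

  -- The bets balance exactly for the factor c because c e = 1, and a factor 2^-s of at most c only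
  -- lowers the left-hand side.
  d-supergale : ∀ s → (∀ q → real (2^- s) ∋ q → q ℚ.≤ c) → IsSupergale s d
  d-supergale s 2^-s≤c w q (inj₁ q<0) = ℚ.<-≤-trans q<0 (0≤productℚ 0≤bet w)
  d-supergale s 2^-s≤c w q (inj₂ (r , t , 0≤r , 0≤t , 2^-s∋r , (x , y , x< , y< , t≤) , q≤rt)) =
    begin-strict
      q                      ≤⟨ q≤rt ⟩
      r ℚ.* t                ≤⟨ ℚ.*-monoʳ-≤-nonNeg t {{ℚ.nonNegative 0≤t}} (2^-s≤c r 2^-s∋r) ⟩
      c ℚ.* t                <⟨ ℚ.*-monoʳ-<-pos c {{ℚ.positive 0<c}} t<ev ⟩
      c ℚ.* (e ℚ.* v w)      ≡⟨ ℚ.*-assoc c e (v w) ⟨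
      c ℚ.* e ℚ.* v w        ≡⟨ cong (ℚ._* v w) ce≡1 ⟩
      1ℚ ℚ.* v w             ≡⟨ ℚ.*-identityˡ (v w) ⟩
      v w                    ∎
    where
    open ℚ.≤-Reasoning
    t<ev : t ℚ.< e ℚ.* v w
    t<ev = ℚ.≤-<-trans t≤ (subst (x ℚ.+ y ℚ.<_) (v-children w) (ℚ.+-mono-< x< y<))

  module _ {S : Cantor} (S⊆χ : ∀ n → T (S n) → T (χ n)) where

    v-prefix : ∀ n → v (prefix S n) ≡ e ^ℚ n ℚ.* ½ ^ℚ count χ n
    v-prefix zero    = refl
    v-prefix (suc n) = begin
      v (prefix S (suc n))
        ≡⟨ cong v (List.applyUpTo-∷ʳ S n) ⟨
      v (prefix S n ∷ʳ S n)
        ≡⟨ productℚ-∷ʳ bet (prefix S n) (S n) ⟩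
      v (prefix S n) ℚ.* bet (length (prefix S n)) (S n)
        ≡⟨ cong₂ (λ x m → x ℚ.* bet m (S n)) (v-prefix n) (List.length-applyUpTo S n) ⟩
      e ^ℚ n ℚ.* ½ ^ℚ count χ n ℚ.* bet n (S n)
        ≡⟨ step (χ n) (S n) (S⊆χ n) (e ^ℚ n) (½ ^ℚ count χ n) ⟩
      e ^ℚ suc n ℚ.* ½ ^ℚ toℕ (χ n) ℚ.* ½ ^ℚ count χ n
        ≡⟨ ℚ.*-assoc (e ^ℚ suc n) (½ ^ℚ toℕ (χ n)) (½ ^ℚ count χ n) ⟩
      e ^ℚ suc n ℚ.* (½ ^ℚ toℕ (χ n) ℚ.* ½ ^ℚ count χ n)
        ≡⟨ cong (e ^ℚ suc n ℚ.*_) (ℚ^.^-homo-* ½ (toℕ (χ n)) (count χ n)) ⟨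
      e ^ℚ suc n ℚ.* ½ ^ℚ count χ (suc n) ∎
      where
      open ≡-Reasoning
      open +-*-Solver
      step : ∀ a b → (T b → T a) → ∀ x y →
        x ℚ.* y ℚ.* (if a then e ℚ.* ½ else (if b then 0ℚ else e)) ≡
        e ℚ.* x ℚ.* ½ ^ℚ toℕ a ℚ.* y
      step true  b     _   x y = solve 3 (λ x y e → x :* y :* (e :* con ½) := e :* x :* con ½ :* y) refl x y e
      step false false _   x y = solve 3 (λ x y e → x :* y :* e := e :* x :* con 1ℚ :* y) refl x y e
      step false true  b⇒a x y with () ← b⇒a tt

    -- Over one period the capital is multiplied by at least ρ = e^K 2^-p, and the hypothesis says ρ
    -- > 1 because e = 1 / c.
    d-succeeds : c ^ℚ (2 ℕ.^ k) ℚ.< ½ ^ℚ p → SucceedsOn d S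
    d-succeeds c^K<½^p M N =
      let q , M∌q      = ℝ.bounded M
          j , N≤j , q<ρʲ = powers-unbounded 1<ρ q N
      in j ℕ.* K , ℕ.≤-trans N≤j (ℕ.m≤m*n j K {{ℕ.m^n≢0 2 k}}) , q , M∌q , ℚ.<-≤-trans q<ρʲ (ρʲ≤v j)
      where
      open ℚ.≤-Reasoning
      K = 2 ℕ.^ k
      0≤e = ℚ.<⇒≤ 0<e
      ρ = e ^ℚ K ℚ.* ½ ^ℚ p
      1<ρ : 1ℚ ℚ.< ρ
      1<ρ = begin-strict
        1ℚ                       ≡⟨ 1^n K ⟨
        1ℚ ^ℚ K                  ≡⟨ cong (_^ℚ K) (trans (ℚ.*-comm e c) ce≡1) ⟨
        (e ℚ.* c) ^ℚ K           ≡⟨ ℚ^.^-distrib-* e c K ⟩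
        e ^ℚ K ℚ.* c ^ℚ K        <⟨ ℚ.*-monoʳ-<-pos (e ^ℚ K) {{ℚ.positive (0<p^n 0<e K)}} c^K<½^p ⟩
        ρ                        ∎
      ρʲ≤v : ∀ j → ρ ^ℚ j ℚ.≤ v (prefix S (j ℕ.* K))
      ρʲ≤v j = begin
        ρ ^ℚ j
          ≡⟨ ℚ^.^-distrib-* (e ^ℚ K) (½ ^ℚ p) j ⟩
        (e ^ℚ K) ^ℚ j ℚ.* (½ ^ℚ p) ^ℚ j
          ≡⟨ cong₂ ℚ._*_ (trans (ℚ^.^-assocʳ e K j) (cong (e ^ℚ_) (ℕ.*-comm K j)))
                         (trans (ℚ^.^-assocʳ ½ p j) (cong (½ ^ℚ_) (ℕ.*-comm p j))) ⟩
        e ^ℚ (j ℕ.* K) ℚ.* ½ ^ℚ (j ℕ.* p)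

            ≤⟨ ℚ.*-monoˡ-≤-nonNeg (e ^ℚ (j ℕ.* K)) {{ℚ.nonNegative (0≤p^n 0≤e (j ℕ.* K))}} (½^-antitone count≤) ⟩
        e ^ℚ (j ℕ.* K) ℚ.* ½ ^ℚ count χ (j ℕ.* K)
          ≡⟨ v-prefix (j ℕ.* K) ⟨
        v (prefix S (j ℕ.* K)) ∎
        where
        count≤ : count χ (j ℕ.* K) ℕ.≤ j ℕ.* p
        -- A threshold above 1 has p > K; the count is then j K, still at most j p.
        count≤ = ℕ.≤-trans (ℕ.≤-reflexive (count-belowVdC k p j)) (ℕ.*-monoʳ-≤ j (ℕ.m⊓n≤m p K))

-- Constructive supergales are countable

p≤0⇒cp≤0 : ∀ {c p} → 0ℚ ℚ.≤ c → p ℚ.≤ 0ℚ → c ℚ.* p ℚ.≤ 0ℚ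
p≤0⇒cp≤0 {c} {p} 0≤c p≤0 = subst (c ℚ.* p ℚ.≤_) (ℚ.*-zeroʳ c)
  (ℚ.*-monoˡ-≤-nonNeg c {{ℚ.nonNegative 0≤c}} p≤0)

-- The first three fields compute the triples of `Computableℚ`, the next two give the rational
-- factor, and `bound` is the datum that `ε` normalises by.
record Code : Set where
  constructor code
  field
    a b c : Rec 2
    num den-1 bound : ℕ

  ratio : ℚ
  ratio = (+ num) ℚ./ suc den-1

  -- The cut of the supremum over t of the coded approximations. Referring to halting computations
  -- gives it a meaning for partial codes as well.
  Value : String → ℚ → Set
  Value w q = ∃[ t ] ∃[ x ] ∃[ y ] ∃[ z ]
    (a [ encode w ∷ t ∷ [] ]⇓ x × b [ encode w ∷ t ∷ [] ]⇓ y × c [ encode w ∷ t ∷ [] ]⇓ z ×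
     q ℚ.< (x ℤ.⊖ y) ℚ./ suc z)

  -- The cut of 0 does not contain 0, which `E-nonpos` demands, so the nonpositive rationals are
  -- added.
  Value₀ : String → ℚ → Set
  Value₀ w q = q ℚ.≤ 0ℚ ⊎ Value w q

  Valid : Set
  Valid =
    (∀ w {q r} → Value₀ (w ∷ʳ false) q → Value₀ (w ∷ʳ true) r → Value₀ w (ratio ℚ.* (q ℚ.+ r))) ×
    (∀ {q} → Value₀ [] q → q ℚ.≤ ι (suc bound))

  0≤ratio : 0ℚ ℚ.≤ ratio
  0≤ratio = ℚ.nonNegative⁻¹ ratio {{ℚ.normalize-nonNeg num (suc den-1)}}

  -- Invalid codes stand for the zero supergale.
  Member : String → ℚ → Set
  Member w q = q ℚ.≤ 0ℚ ⊎ (Valid × Value₀ w q)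

  member-supergale : ∀ w {q r} → Member (w ∷ʳ false) q → Member (w ∷ʳ true) r →
    Member w (ratio ℚ.* (q ℚ.+ r))
  member-supergale w (inj₁ q≤0)      (inj₁ r≤0)      = inj₁ (p≤0⇒cp≤0 0≤ratio (ℚ.+-mono-≤ q≤0 r≤0))
  member-supergale w (inj₁ q≤0)      (inj₂ (v , Vr)) = inj₂ (v , proj₁ v w (inj₁ q≤0) Vr)
  member-supergale w (inj₂ (v , Vq)) (inj₁ r≤0)      = inj₂ (v , proj₁ v w Vq (inj₁ r≤0))
  member-supergale w (inj₂ (v , Vq)) (inj₂ (_ , Vr)) = inj₂ (v , proj₁ v w Vq Vr)

  member-initial : ∀ {q} → Member [] q → q ℚ.≤ ι (suc bound)
  member-initial (inj₁ q≤0)      = ℚ.≤-trans q≤0 (0≤ι (suc bound))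
  member-initial (inj₂ (v , Vq)) = proj₂ v Vq

decode : Tree → Code
decode t = code (treeRec 2 (left t)) (treeRec 2 (left t₁)) (treeRec 2 (left t₂))
  (treeℕ (left t₃)) (treeℕ (left t₄)) (treeℕ (right t₄))
  where
  t₁ = right t
  t₂ = right t₁
  t₃ = right t₂
  t₄ = right t₃

decode-surjective : ∀ C → ∃[ i ] decode (tree i) ≡ C
decode-surjective (code a b c num den-1 bound)
  with treeRec-surjective a | treeRec-surjective b | treeRec-surjective c
     | treeℕ-surjective num | treeℕ-surjective den-1 | treeℕ-surjective bound
... | t₀ , refl | t₁ , refl | t₂ , refl | t₃ , refl | t₄ , refl | t₅ , refl
  with tree-surjective (t₀ · t₁ · t₂ · t₃ · t₄ · t₅)
... | i , eq = i , cong decode eq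

coded : Supergales
coded = record
  { E           = λ i → Code.Member (decode (tree i))
  ; c           = λ i → Code.ratio (decode (tree i))
  ; B           = λ i → Code.bound (decode (tree i))
  ; 0≤c         = λ i → Code.0≤ratio (decode (tree i))
  ; E-nonpos    = inj₁
  ; E-supergale = λ {i} {w} → Code.member-supergale (decode (tree i)) w
  ; E-initial   = λ {i} → Code.member-initial (decode (tree i))
  }

module _ {s : ℝ≥0} {d : String → ℝ≥0} (supergale : IsSupergale s d)
  (c : ℚ) (0≤c : 0ℚ ℚ.≤ c) (2^-s∋c : real (2^- s) ∋ c) where

  private
    at : String → ℚ → Set
    at w q = real (d w) ∋ q

    at₀ : String → ℚ → Set
    at₀ w q = q ℚ.≤ 0ℚ ⊎ at w q

    q+r-y<0 : ∀ {q r y} → q ℚ.≤ 0ℚ → r ℚ.< y → q ℚ.+ (r ℚ.- y) ℚ.< 0ℚ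
    q+r-y<0 {q} {r} {y} q≤0 r<y = ℚ.+-mono-≤-< q≤0
      (subst (r ℚ.- y ℚ.<_) (ℚ.+-inverseʳ y) (ℚ.+-monoˡ-< (ℚ.- y) r<y))

    -- A rational q ≤ 0 need not lie in the cut of a zero value. Roundedness lets the other summand
    -- r be raised to some y; the deficit r - y < 0 moves to q, and the resulting negative number is
    -- in every nonnegative cut.
    at-sum : ∀ v w {q r} → at₀ v q → at₀ w r → q ℚ.+ r ℚ.≤ 0ℚ ⊎
      ∃[ x ] ∃[ y ] (at v x × at w y × q ℚ.+ r ℚ.≤ x ℚ.+ y)
    at-sum v w (inj₁ q≤0) (inj₁ r≤0) = inj₁ (ℚ.+-mono-≤ q≤0 r≤0)
    at-sum v w {q} {r} (inj₁ q≤0) (inj₂ w∋r) with ℝ.rounded (real (d w)) w∋r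
    ... | y , r<y , w∋y = inj₂
      ( q ℚ.+ (r ℚ.- y) , y , ℝ≥0.nonneg (d v) _ (q+r-y<0 q≤0 r<y) , w∋y
      , ℚ.≤-reflexive (solve 3 (λ q r y → q :+ r := q :+ (r :- y) :+ y) refl q r y) )
      where open +-*-Solver
    at-sum v w {q} {r} (inj₂ v∋q) (inj₁ r≤0) with ℝ.rounded (real (d v)) v∋q
    ... | x , q<x , v∋x = inj₂
      ( x , r ℚ.+ (q ℚ.- x) , v∋x , ℝ≥0.nonneg (d w) _ (q+r-y<0 r≤0 q<x)
      , ℚ.≤-reflexive (solve 3 (λ q r x → q :+ r := x :+ (r :+ (q :- x))) refl q r x) )
      where open +-*-Solver
    at-sum v w (inj₂ v∋q) (inj₂ w∋r) = inj₂ (_ , _ , v∋q , w∋r , ℚ.≤-refl)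

    at-supergale : ∀ w {q r} → at₀ (w ∷ʳ false) q → at₀ (w ∷ʳ true) r → at₀ w (c ℚ.* (q ℚ.+ r))
    at-supergale w {q} {r} d₀ d₁ with at-sum (w ∷ʳ false) (w ∷ʳ true) d₀ d₁ | ℚ.≤-total (q ℚ.+ r) 0ℚ
    ... | inj₁ q+r≤0 | _          = inj₁ (p≤0⇒cp≤0 0≤c q+r≤0)
    ... | inj₂ _     | inj₁ q+r≤0 = inj₁ (p≤0⇒cp≤0 0≤c q+r≤0)
    ... | inj₂ sum   | inj₂ 0≤q+r = inj₂ (supergale w (c ℚ.* (q ℚ.+ r))
      (inj₂ (c , q ℚ.+ r , 0≤c , 0≤q+r , 2^-s∋c , sum , ℚ.≤-refl)))

    at-initial : ∃[ B ] ∀ {q} → at₀ [] q → q ℚ.≤ ι (suc B)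
    at-initial =
      let b , ∌b = ℝ.bounded (real (d []))
          B , b<B = archimedean b
      in B , λ where
        (inj₁ q≤0) → ℚ.≤-trans q≤0 (0≤ι (suc B))
        (inj₂ ∋q)  → ℚ.≤-trans (ℚ.<⇒≤ (ℚ.<-trans (∋∌⇒< (real (d [])) ∋q ∌b) b<B))
                       (ι-mono-≤ (ℕ.n≤1+n B))

  supergale-coded : Constructive d →
    ∃[ i ] (Supergales.c coded i ≡ c × (∀ w q → real (d w) ∋ q → Supergales.E coded i w q))
  supergale-coded (f̂ , (a , b , z , (ca , ⇓a) , (cb , ⇓b) , (cz , ⇓z) , f̂≡) , mono , lim) =
    helper (decode-surjective C)
    where
    B = proj₁ at-initial
    C = code ca cb cz ℤ.∣ ↥ c ∣ (ℚ.ℚ.denominator-1 c) B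
    module C = Code C

    ratio≡c : ∀ p → 0ℚ ℚ.≤ p → (+ ℤ.∣ ↥ p ∣) ℚ./ ↧ₙ p ≡ p
    ratio≡c p@(mkℚ (+ _) _ _) _   = ℚ.↥p/↧p≡p p
    ratio≡c (mkℚ -[1+ _ ] _ _) (ℚ.*≤* ())

    value⇒at : ∀ {w q} → C.Value w q → at w q
    -- A `Value` comes with whatever outputs the codes produce; determinism identifies them with
    -- those of `f̂`, which stays strictly below d w.
    value⇒at {w} {q} (t , x , y , u , ⇓x , ⇓y , ⇓u , q<)
      rewrite ⇓-functional ⇓x (⇓a w t) | ⇓-functional ⇓y (⇓b w t) | ⇓-functional ⇓u (⇓z w t)
            | sym (f̂≡ w t) =
      let f̂≤ , r , r≮f̂ , d∋r = mono w t
      in ℝ.closed (real (d w)) (ℚ.<-≤-trans q< (ℚ.≤-trans f̂≤ (ℚ.≮⇒≥ r≮f̂))) d∋r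

    at⇒value : ∀ {w q} → at w q → C.Value w q
    at⇒value {w} {q} d∋q with ℝ.rounded (real (d w)) d∋q
    -- At tolerance r - q the approximation exceeds r - (r - q) = q, because r is still below d w.
    ... | r , q<r , d∋r with lim w (r ℚ.- q) (subst (ℚ._< r ℚ.- q) (ℚ.+-inverseʳ q) (ℚ.+-monoˡ-< (ℚ.- q) q<r))
    ... | N , near with near N ℕ.≤-refl
    ... | _ , u , d∌u , u< = N , _ , _ , _ , ⇓a w N , ⇓b w N , ⇓z w N ,
      subst (q ℚ.<_) (f̂≡ w N) (subst₂ ℚ._<_
        (solve 2 (λ r q → r :- (r :- q) := q) refl r q)
        (solve 3 (λ f r q → f :+ (r :- q) :- (r :- q) := f) refl (f̂ w N) r q)
        (ℚ.+-monoˡ-< (ℚ.- (r ℚ.- q)) (ℚ.<-trans (∋∌⇒< (real (d w)) d∋r d∌u) u<)))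
      where open +-*-Solver

    value₀⇒at₀ : ∀ {w q} → C.Value₀ w q → at₀ w q
    value₀⇒at₀ (inj₁ q≤0) = inj₁ q≤0
    value₀⇒at₀ (inj₂ v)   = inj₂ (value⇒at v)

    at₀⇒value₀ : ∀ {w q} → at₀ w q → C.Value₀ w q
    at₀⇒value₀ (inj₁ q≤0) = inj₁ q≤0
    at₀⇒value₀ (inj₂ d∋q) = inj₂ (at⇒value d∋q)

    C-valid : C.Valid
    C-valid = (λ w v₀ v₁ → subst (λ c → C.Value₀ w (c ℚ.* _)) (sym (ratio≡c c 0≤c))
                  (at₀⇒value₀ (at-supergale w (value₀⇒at₀ v₀) (value₀⇒at₀ v₁))))
            , λ v → proj₂ at-initial (value₀⇒at₀ v)

    helper : ∃[ i ] decode (tree i) ≡ C →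
      ∃[ i ] (Supergales.c coded i ≡ c × (∀ w q → at w q → Supergales.E coded i w q))
    helper (i , eq) = i , trans (cong Code.ratio eq) (ratio≡c c 0≤c) ,
      λ w q d∋q → inj₂ (subst (λ C → Code.Valid C × Code.Value₀ C w q) (sym eq)
        (C-valid , inj₂ (at⇒value d∋q)))

-- The sequence of dimension α

ι-cancel-≤ : ∀ {m n} → ι m ℚ.≤ ι n → m ℕ.≤ n
ι-cancel-≤ {m} {n} (ℚ.*≤* le) =
  ℤ.drop‿+≤+ (subst₂ ℤ._≤_ (ℤ.*-identityʳ (+ m)) (ℤ.*-identityʳ (+ n)) le)

ι-cancel-< : ∀ {m n} → ι m ℚ.< ι n → m ℕ.< n
ι-cancel-< ιm<ιn = ℕ.≰⇒> λ n≤m → ℚ.<-irrefl refl (ℚ.<-≤-trans ιm<ιn (ι-mono-≤ n≤m))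

dyadic : ℕ → ℕ → ℚ
dyadic k p = ι p ℚ.* ½ ^ℚ k

½^*2^ : ∀ k → ½ ^ℚ k ℚ.* ι (2 ℕ.^ k) ≡ 1ℚ
½^*2^ zero    = refl
½^*2^ (suc k) = begin
  ½ ℚ.* ½ ^ℚ k ℚ.* ι (2 ℕ.* 2 ℕ.^ k)          ≡⟨ cong (½ ℚ.* ½ ^ℚ k ℚ.*_) (ι-* 2 (2 ℕ.^ k)) ⟩
  ½ ℚ.* ½ ^ℚ k ℚ.* (ι 2 ℚ.* ι (2 ℕ.^ k))
    ≡⟨ solve 2 (λ h k → con ½ :* h :* (con (ι 2) :* k) := h :* k) refl (½ ^ℚ k) (ι (2 ℕ.^ k)) ⟩
  ½ ^ℚ k ℚ.* ι (2 ℕ.^ k)                      ≡⟨ ½^*2^ k ⟩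
  1ℚ                                          ∎
  where
  open ≡-Reasoning
  open +-*-Solver

dyadic*2^ : ∀ k p → dyadic k p ℚ.* ι (2 ℕ.^ k) ≡ ι p
dyadic*2^ k p = trans (ℚ.*-assoc (ι p) (½ ^ℚ k) (ι (2 ℕ.^ k)))
  (trans (cong (ι p ℚ.*_) (½^*2^ k)) (ℚ.*-identityʳ (ι p)))

cross-*-mono-< : ∀ {x y} p K q L .{{_ : ℕ.NonZero K}} .{{_ : ℕ.NonZero L}} →
  x ℚ.* ι K ≡ ι p → y ℚ.* ι L ≡ ι q → x ℚ.< y → p ℕ.* L ℕ.< q ℕ.* K
cross-*-mono-< {x} {y} p K@(suc _) q L@(suc _) xK≡p yL≡q x<y = ι-cancel-< (begin-strict
  ι (p ℕ.* L)             ≡⟨ ι-* p L ⟩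
  ι p ℚ.* ι L             ≡⟨ cong (ℚ._* ι L) xK≡p ⟨
  x ℚ.* ι K ℚ.* ι L       <⟨ ℚ.*-monoˡ-<-pos (ι L) (ℚ.*-monoˡ-<-pos (ι K) x<y) ⟩
  y ℚ.* ι K ℚ.* ι L       ≡⟨ solve 3 (λ y k l → y :* k :* l := y :* l :* k) refl y (ι K) (ι L) ⟩
  y ℚ.* ι L ℚ.* ι K       ≡⟨ cong (ℚ._* ι K) yL≡q ⟩
  ι q ℚ.* ι K             ≡⟨ ι-* q K ⟨
  ι (q ℕ.* K)             ∎)
  where
  open ℚ.≤-Reasoning
  open +-*-Solver

½^-small : ∀ δ → 0ℚ ℚ.< δ → ∃[ k ] ½ ^ℚ k ℚ.< δ
½^-small δ 0<δ =
  let N , small    = 1/suc-small δ 0<δ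
      k , _ , N<2ᵏ = powers-unbounded {2ℚ} (ℚ.*<* (ℤ.+<+ (s≤s (s≤s z≤n)))) (ι (suc N)) 0
  in k , ℚ.<-trans (½ᵏ<1/suc k N N<2ᵏ) (small N ℕ.≤-refl)
  where
  ½ᵏ<1/suc : ∀ k N → ι (suc N) ℚ.< 2ℚ ^ℚ k → ½ ^ℚ k ℚ.< 1/suc N
  ½ᵏ<1/suc k N N<2ᵏ = ℚ.*-cancelʳ-<-nonNeg (ι (suc N)) (begin-strict
    ½ ^ℚ k ℚ.* ι (suc N)     <⟨ ℚ.*-monoʳ-<-pos (½ ^ℚ k) {{ℚ.positive (0<p^n (ℚ.positive⁻¹ ½) k)}} N<2ᵏ ⟩
    ½ ^ℚ k ℚ.* 2ℚ ^ℚ k       ≡⟨ ℚ^.^-distrib-* ½ 2ℚ k ⟨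
    1ℚ ^ℚ k                  ≡⟨ 1^n k ⟩
    1ℚ                       ≡⟨ ℚ.*-inverseˡ (ι (suc N)) ⟨
    1/suc N ℚ.* ι (suc N)    ∎)
    where open ℚ.≤-Reasoning

p<q⇒0<q-p : ∀ {p q} → p ℚ.< q → 0ℚ ℚ.< q ℚ.- p
p<q⇒0<q-p {p} {q} p<q = subst (ℚ._< q ℚ.- p) (ℚ.+-inverseʳ p) (ℚ.+-monoˡ-< (ℚ.- p) p<q)

neg-cancel-< : ∀ {p q} → ℚ.- p ℚ.< ℚ.- q → q ℚ.< p
neg-cancel-< {p} {q} -p<-q =
  subst₂ ℚ._<_ (neg-involutive q) (neg-involutive p) (ℚ.neg-antimono-< -p<-q)

neg-cancel-≤ : ∀ {p q} → ℚ.- p ℚ.≤ ℚ.- q → q ℚ.≤ p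
neg-cancel-≤ {p} {q} -p≤-q =
  subst₂ ℚ._≤_ (neg-involutive q) (neg-involutive p) (ℚ.neg-antimono-≤ -p≤-q)

dyadic-dense : ∀ {q r} → 0ℚ ℚ.≤ q → q ℚ.< r →
  ∃[ k ] ∃[ p ] (q ℚ.< dyadic k p × dyadic k p ℚ.< r)
dyadic-dense {q} {r} 0≤q q<r =
  let k , ½ᵏ<r-q            = ½^-small (r ℚ.- q) (p<q⇒0<q-p q<r)
      N , q2ᵏ<N             = archimedean (q ℚ.* ι (2 ℕ.^ k))
      -- `crossing` detects a fall, so the multiples of 2^-k are negated to find the step that
      -- passes q; it is too short to reach r.
      j , -q≤-j , -[1+j]<-q = crossing (λ j → ℚ.- dyadic k j) (ℚ.- q) N (-q≤-0 k) (-N<-q k N q2ᵏ<N)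
  in k , suc j , neg-cancel-< -[1+j]<-q , next<r k j (neg-cancel-≤ -q≤-j) ½ᵏ<r-q
  where
  open ℚ.≤-Reasoning
  open +-*-Solver
  -q≤-0 : ∀ k → ℚ.- q ℚ.≤ ℚ.- dyadic k 0
  -q≤-0 k = ℚ.neg-antimono-≤ (subst (ℚ._≤ q) (sym (ℚ.*-zeroˡ (½ ^ℚ k))) 0≤q)
  -N<-q : ∀ k N → q ℚ.* ι (2 ℕ.^ k) ℚ.< ι N → ℚ.- dyadic k N ℚ.< ℚ.- q
  -N<-q k N q2ᵏ<N = ℚ.neg-antimono-< (ℚ.*-cancelʳ-<-nonNeg (ι (2 ℕ.^ k))
    (subst (q ℚ.* ι (2 ℕ.^ k) ℚ.<_) (sym (dyadic*2^ k N)) q2ᵏ<N))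
  next<r : ∀ k j → dyadic k j ℚ.≤ q → ½ ^ℚ k ℚ.< r ℚ.- q → dyadic k (suc j) ℚ.< r
  next<r k j j≤q ½ᵏ<r-q = begin-strict
    ι (suc j) ℚ.* ½ ^ℚ k      ≡⟨ cong (ℚ._* ½ ^ℚ k) (ι-+ 1 j) ⟩
    (1ℚ ℚ.+ ι j) ℚ.* ½ ^ℚ k
      ≡⟨ solve 2 (λ j h → (con 1ℚ :+ j) :* h := j :* h :+ h) refl (ι j) (½ ^ℚ k) ⟩
    dyadic k j ℚ.+ ½ ^ℚ k     <⟨ ℚ.+-mono-≤-< j≤q ½ᵏ<r-q ⟩
    q ℚ.+ (r ℚ.- q)           ≡⟨ solve 2 (λ q r → q :+ (r :- q) := r) refl q r ⟩
    r                         ∎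

-- From s ≤ r < r′ the exponent - r′ lies strictly below - s, and the last hypothesis reads c′ ≤
-- 2^-r′. Matching on `mkℚ` lets the numerator of - r′ compute.
2^-∋ : ∀ s {r r′ c c′} → ¬ real s ∋ r → r ℚ.< r′ → 0ℚ ℚ.< r′ → c ℚ.< c′ → 0ℚ ℚ.≤ c′ →
  c′ ^ℚ ↧ₙ r′ ℚ.≤ ½ ^ℚ ℤ.∣ ↥ r′ ∣ → real (2^- s) ∋ c
2^-∋ s {r} {r′@(mkℚ (+ suc n) _ _)} {c′ = c′} s∌r r<r′ _ c<c′ 0≤c′ c′≤ =
  c′ , ℚ.- r′ , c<c′ , 0≤c′ ,
  (ℚ.- r , ℚ.neg-antimono-< r<r′ , subst (λ q → ¬ real s ∋ q) (sym (neg-involutive r)) s∌r) , c′≤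
2^-∋ s {r′ = mkℚ (+ zero) _ _}  _ _ (ℚ.*<* (ℤ.+<+ ()))
2^-∋ s {r′ = mkℚ -[1+ _ ] _ _} _ _ (ℚ.*<* ())

-- A nonnegative q′ that witnesses membership in the cut satisfies q′ ≤ 2^r for some r < - σ.
-- Raising this and 2^-σ ≤ c to the product of the two denominators leaves powers of ½ with integer
-- exponents to compare.
2^-≤ : ∀ {σ} (0≤σ : 0ℝ ≤ ⟦ σ ⟧) {c} → 0ℚ ℚ.< σ → 0ℚ ℚ.≤ c → ½ ^ℚ ℤ.∣ ↥ σ ∣ ℚ.≤ c ^ℚ ↧ₙ σ →
  ∀ q → real (2^- mkℝ≥0 ⟦ σ ⟧ 0≤σ) ∋ q → q ℚ.≤ c
2^-≤ {σ@(mkℚ (+ P) l _)} _ {c} 0<σ 0≤c ½^P≤c^L q (q′ , r , q<q′ , 0≤q′ , (q″ , r<q″ , -q″≮σ) , q′^m≤) =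
  ℚ.≤-trans (ℚ.<⇒≤ q<q′) (go r r<0 σ<-r q′^m≤)
  where
  σ<-r : σ ℚ.< ℚ.- r
  σ<-r = ℚ.≤-<-trans (ℚ.≮⇒≥ -q″≮σ) (ℚ.neg-antimono-< r<q″)
  r<0 : r ℚ.< 0ℚ
  r<0 = neg-cancel-< (ℚ.<-trans 0<σ σ<-r)
  go : ∀ r → r ℚ.< 0ℚ → σ ℚ.< ℚ.- r → q′ ^ℚ ↧ₙ r ℚ.≤ 2^ℤ (↥ r) → q′ ℚ.≤ c
  go (mkℚ (+ zero) _ _)  (ℚ.*<* (ℤ.+<+ ()))
  go (mkℚ (+ suc _) _ _) (ℚ.*<* (ℤ.+<+ ()))
  go (mkℚ -[1+ n ] d _)  _ (ℚ.*<* σ<-r) q′^m≤ = ^-cancelˡ-≤ 0≤c (pred (m ℕ.* L)) (begin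
    q′ ^ℚ (m ℕ.* L)                ≡⟨ ℚ^.^-assocʳ q′ m L ⟨
    (q′ ^ℚ m) ^ℚ L                 ≤⟨ ^-monoˡ-≤ (0≤p^n 0≤q′ m) q′^m≤ L ⟩
    (½ ^ℚ suc n) ^ℚ L              ≡⟨ ℚ^.^-assocʳ ½ (suc n) L ⟩
    ½ ^ℚ (suc n ℕ.* L)             ≤⟨ ½^-antitone (ℕ.<⇒≤ Pm<nL) ⟩
    ½ ^ℚ (P ℕ.* m)                 ≡⟨ ℚ^.^-assocʳ ½ P m ⟨
    (½ ^ℚ P) ^ℚ m                  ≤⟨ ^-monoˡ-≤ (0≤p^n 0≤½ P) ½^P≤c^L m ⟩
    (c ^ℚ L) ^ℚ m                  ≡⟨ ℚ^.^-assocʳ c L m ⟩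
    c ^ℚ (L ℕ.* m)                 ≡⟨ cong (c ^ℚ_) (ℕ.*-comm L m) ⟩
    c ^ℚ (m ℕ.* L)                 ∎)
    where
    open ℚ.≤-Reasoning
    m = suc d
    L = suc l
    Pm<nL : P ℕ.* m ℕ.< suc n ℕ.* L
    Pm<nL = ℤ.drop‿+<+ (subst₂ ℤ._<_ (sym (ℤ.pos-* P m)) (sym (ℤ.pos-* (suc n) L)) σ<-r)
2^-≤ {mkℚ -[1+ _ ] _ _} _ (ℚ.*<* ())

-- The two factors are separated by applying rational-root on both sides of the
-- mediant (p + i) / (2 ^ k + m) of r = i / m and p / 2 ^ k.
below-2^- : ∀ s {r r′} k p → ¬ real s ∋ r → r ℚ.< r′ → 0ℚ ℚ.< r′ → r′ ℚ.< dyadic k p →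
  ∃[ c ] (0ℚ ℚ.< c × c ℚ.≤ 1ℚ × real (2^- s) ∋ c × ½ ^ℚ p ℚ.≤ c ^ℚ (2 ℕ.^ k))
below-2^- s {r} {r′} k p s∌r r<r′ 0<r′ r′<p/K =
  let c′ , 0<c′ , _ , c′^m<½^i , ½^[p+i]≤c′^[K+m] =
        rational-root m (K ℕ.+ m) i (p ℕ.+ i) {{_}} {{K+m≢0}} lt₁
      c , 0<c , c≤1 , c^[K+m]<½^[p+i] , ½^p≤c^K =
        rational-root (K ℕ.+ m) K (p ℕ.+ i) p {{K+m≢0}} lt₂
      0≤c′ = ℚ.<⇒≤ 0<c′
      c<c′ = ^-cancelˡ-< 0≤c′ (K ℕ.+ m) (ℚ.<-≤-trans c^[K+m]<½^[p+i] ½^[p+i]≤c′^[K+m])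
  in c , 0<c , c≤1 , 2^-∋ s s∌r r<r′ 0<r′ c<c′ 0≤c′ (ℚ.<⇒≤ c′^m<½^i) , ½^p≤c^K
  where
  i = ℤ.∣ ↥ r′ ∣
  m = ↧ₙ r′
  K = 2 ℕ.^ k
  instance
    K≢0 : ℕ.NonZero K
    K≢0 = ℕ.m^n≢0 2 k
  K+m≢0 : ℕ.NonZero (K ℕ.+ m)
  K+m≢0 = ℕ.>-nonZero (ℕ.m≤n⇒m≤o+n K (s≤s z≤n))
  iK<pm : i ℕ.* K ℕ.< p ℕ.* m
  iK<pm = cross-*-mono-< i m p K (p*ι↧p r′ (ℚ.<⇒≤ 0<r′)) (dyadic*2^ k p) r′<p/K
  lt₁ : i ℕ.* (K ℕ.+ m) ℕ.< (p ℕ.+ i) ℕ.* m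
  lt₁ = subst₂ ℕ._<_ (sym (ℕ.*-distribˡ-+ i K m)) (sym (ℕ.*-distribʳ-+ m p i))
    (ℕ.+-monoˡ-< (i ℕ.* m) iK<pm)
  lt₂ : (p ℕ.+ i) ℕ.* K ℕ.< p ℕ.* (K ℕ.+ m)
  lt₂ = subst₂ ℕ._<_ (sym (ℕ.*-distribʳ-+ K p i)) (sym (ℕ.*-distribˡ-+ p K m))
    (ℕ.+-monoʳ-< (p ℕ.* K) iK<pm)

-- As σ is rational and `2^-≤` allows 2^-σ = c, one application of `rational-root` between p / 2^k
-- and σ suffices, with no mediant.
above-2^- : ∀ {σ} (0≤σ : 0ℝ ≤ ⟦ σ ⟧) k p → 0ℚ ℚ.< σ → dyadic k p ℚ.< σ →
  ∃[ c ] (0ℚ ℚ.< c × (∀ q → real (2^- mkℝ≥0 ⟦ σ ⟧ 0≤σ) ∋ q → q ℚ.≤ c) × c ^ℚ (2 ℕ.^ k) ℚ.< ½ ^ℚ p)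
above-2^- {σ} 0≤σ k p 0<σ p/K<σ =
  let c , 0<c , _ , c^K<½^p , ½^P≤c^L = rational-root K (↧ₙ σ) p ℤ.∣ ↥ σ ∣ pL<PK
  in c , 0<c , 2^-≤ 0≤σ 0<σ (ℚ.<⇒≤ 0<c) ½^P≤c^L , c^K<½^p
  where
  K = 2 ℕ.^ k
  instance
    K≢0 : ℕ.NonZero K
    K≢0 = ℕ.m^n≢0 2 k
  pL<PK : p ℕ.* ↧ₙ σ ℕ.< ℤ.∣ ↥ σ ∣ ℕ.* K
  pL<PK = cross-*-mono-< p K ℤ.∣ ↥ σ ∣ (↧ₙ σ) (dyadic*2^ k p) (p*ι↧p σ (ℚ.<⇒≤ 0<σ)) p/K<σ

-- The two inequalities for the dimension

SucceedsOn-cong : ∀ {d S T} → S ≗ T → SucceedsOn d S → SucceedsOn d T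
SucceedsOn-cong {d} {S} {T} S≗T succeeds M N =
  let n , N≤n , M<d = succeeds M N
  in n , N≤n , subst (λ w → M < real (d w)) (applyUpTo-cong S≗T n) M<d
  where
  applyUpTo-cong : ∀ {S T} → S ≗ T → ∀ n → prefix S n ≡ prefix T n
  applyUpTo-cong S≗T zero    = refl
  applyUpTo-cong S≗T (suc n) = cong₂ _∷_ (S≗T 0) (applyUpTo-cong (S≗T ∘ suc) n)

module _ (em : ∀ (P : Set) → Dec P) (α : ℝ) (0≤α : 0ℝ ≤ α) (α≤1 : α ≤ 1ℝ) where

  private
    -- This is θ(n) < α, with a dyadic rational in between because θ is accessible only through
    -- `belowVdC`.
    Free : ℕ → Set
    Free n = ∃[ k ] ∃[ p ] (α ∋ dyadic k p × T (belowVdC k p n))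

    A : ℕ → Bool
    A n = ⌊ em (Free n) ⌋

    open Diagonal em coded A

    0≤-∌ : ∀ x {q} → 0ℝ ≤ x → ¬ x ∋ q → 0ℚ ℚ.≤ q
    0≤-∌ x 0≤x x∌q = ℚ.≮⇒≥ λ q<0 → x∌q (0≤x _ q<0)

    Admissible : ℝ≥0 → Set₁
    Admissible s = Σ[ d ∈ (String → ℝ≥0) ]
      (IsSupergale s d × Constructive d × (∀ T → ｛ S ｝ T → S^∞[ d ] T))

    α-lower : ∀ s → Admissible s → α ≤ real s
    α-lower s (d , supergale , constructive , succeeds) r α∋r =
      decidable-stable (em (real s ∋ r)) λ s∌r →
        let 0≤r = 0≤-∌ (real s) (ℝ≥0.nonneg s) s∌r
            -- Two steps up inside α: r < r₁ leaves room for a rational factor below 2^-s, and r₂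
            -- keeps the dyadic p / 2^k above r₁ inside α.
            r₁ , r<r₁ , α∋r₁ = ℝ.rounded α α∋r
            r₂ , r₁<r₂ , α∋r₂ = ℝ.rounded α α∋r₁
            0<r₁ = ℚ.≤-<-trans 0≤r r<r₁
            k , p , r₁<p/K , p/K<r₂ = dyadic-dense (ℚ.<⇒≤ 0<r₁) r₁<r₂
            α∋p/K = ℝ.closed α p/K<r₂ α∋r₂
            c , 0<c , c≤1 , 2^-s∋c , ½^p≤c^K = below-2^- s k p s∌r r<r₁ 0<r₁ r₁<p/K
            i , cᵢ≡c , d⊆E = supergale-coded {s} {d} supergale c (ℚ.<⇒≤ 0<c) 2^-s∋c constructive
            b , bounded = S-bounded {i} k p (p≤2^ k p (α≤1 _ α∋p/K))
              (subst (0ℚ ℚ.<_) (sym cᵢ≡c) 0<c) (subst (ℚ._≤ 1ℚ) (sym cᵢ≡c) c≤1)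
              (subst (λ c → ½ ^ℚ p ℚ.≤ c ^ℚ (2 ℕ.^ k)) (sym cᵢ≡c) ½^p≤c^K)
              (λ n below → fromWitness (k , p , α∋p/K , below))
            n , _ , q , q≮b , d∋q = succeeds S (λ _ → refl) ⟦ b ⟧ 0
            -- Success only provides some q ≥ b in the cut, which the bound b still permits;
            -- rounding up passes b strictly.
            q′ , q<q′ , d∋q′ = ℝ.rounded (real (d (prefix S n))) d∋q
        in q≮b (ℚ.<-≤-trans q<q′ (bounded n q′ (d⊆E _ _ d∋q′)))
      where
      p≤2^ : ∀ k p → dyadic k p ℚ.< 1ℚ → p ℕ.≤ 2 ℕ.^ k
      p≤2^ k p p/K<1 = ι-cancel-≤ (begin
        ι p                            ≡⟨ dyadic*2^ k p ⟨
        dyadic k p ℚ.* ι (2 ℕ.^ k)     ≤⟨ ℚ.*-monoʳ-≤-nonNeg (ι (2 ℕ.^ k)) (ℚ.<⇒≤ p/K<1) ⟩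
        1ℚ ℚ.* ι (2 ℕ.^ k)             ≡⟨ ℚ.*-identityˡ (ι (2 ℕ.^ k)) ⟩
        ι (2 ℕ.^ k)                    ∎)
        where open ℚ.≤-Reasoning

    α-greatest : ∀ y → (∀ s → Admissible s → y ≤ real s) → y ≤ α
    α-greatest y lower q y∋q = decidable-stable (em (α ∋ q)) λ α∌q →
      let 0≤q = 0≤-∌ α 0≤α α∌q
          r , q<r , y∋r = ℝ.rounded y y∋q
          -- In α ≤ q < p / 2^k < σ < r the dyadic number supplies the set to bet on and σ an
          -- admissible exponent; as y contains r, this would force r < σ.
          σ , q<σ , σ<r = ℚ.<-dense q<r
          0<σ = ℚ.≤-<-trans 0≤q q<σ
          0≤σ = λ x x<0 → ℚ.<-trans x<0 0<σ
          k , p , q<p/K , p/K<σ = dyadic-dense 0≤q q<σ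
          c , 0<c , 2^-σ≤c , c^K<½^p = above-2^- 0≤σ k p 0<σ p/K<σ
          e , 0<e , ce≡1 = inverse 0<c
          module Bet = Betting k p c e 0<c 0<e ce≡1
          S⊆χ = λ n Sn → A⊆below k p (λ k′ p′ α∋ → ℚ.<-trans (∋∌⇒< α α∋ α∌q) q<p/K) n
                  (toWitness (S⊆A n Sn))
          s = mkℝ≥0 ⟦ σ ⟧ 0≤σ
          succeeds = λ T S≗T → SucceedsOn-cong {Bet.d} S≗T (Bet.d-succeeds S⊆χ c^K<½^p)
          σ∋r = lower s (Bet.d , Bet.d-supergale s 2^-σ≤c , Bet.d-constructive , succeeds) r y∋r
      in ℚ.<-asym σ<r σ∋r
      where
      inverse : ∀ {c} → 0ℚ ℚ.< c → ∃[ e ] (0ℚ ℚ.< e × c ℚ.* e ≡ 1ℚ)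
      inverse {c} 0<c = ℚ.1/ c , ℚ.positive⁻¹ (ℚ.1/ c) {{ℚ.1/pos⇒pos c}} , ℚ.*-inverseʳ c
        where
        instance
          c>0 : ℚ.Positive c
          c>0 = ℚ.positive 0<c
          c≢0 : ℚ.NonZero c
          c≢0 = ℚ.pos⇒nonZero c
      A⊆below : ∀ k p → (∀ k′ p′ → α ∋ dyadic k′ p′ → dyadic k′ p′ ℚ.< dyadic k p) →
        ∀ n → Free n → T (belowVdC k p n)
      A⊆below k p α<p/K n (k′ , p′ , α∋ , below) = belowVdC-mono k′ k p′ p n
        (ℕ.<⇒≤ (cross-*-mono-< p′ (2 ℕ.^ k′) p (2 ℕ.^ k) {{ℕ.m^n≢0 2 k′}} {{ℕ.m^n≢0 2 k}}
          (dyadic*2^ k′ p′) (dyadic*2^ k p) (α<p/K k′ p′ α∋)))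
        below

  has-dimension : ∃[ S ] HasDim S α
  has-dimension = S , α-lower , α-greatest

theorem6p4 : ExcludedMiddle (lsuc 0ℓ) →
    ∀ (α : ℝ) → 0ℝ ≤ α → α ≤ 1ℝ → ∃[ S ] HasDim S α
theorem6p4 em = has-dimension λ P → map′ lower lift (em {Lift (lsuc 0ℓ) P})
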